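{- Let $\mathcal{H}$ be a finite family of connected graphs. (i) There exists a constant $c(\mathcal{H})$ with $\mathrm{ispc}(G)\le c(\mathcal{H})$ for every connected $\mathcal{H}$-free graph $G$ if and only if $\mathcal{H}\le\{K_n,K_{1,n},F^{(1)}_n,F^{(2)}_n\}$ for some integer $n\ge4$. (ii) There exists a constant $c(\mathcal{H})$ with $\mathrm{ispp}(G)\le c(\mathcal{H})$ for every connected $\mathcal{H}$-free graph $G$ if and only if $\mathcal{H}\le\{K_n,K_{1,n},F^{(1)}_n,F^{(2)}_n,F^{(4)}_n,F^{(5)}_n\}$ for some integer $n\ge4$.
   Context: Graphs are finite and simple. $G$ is $\mathcal{H}$-free if it has no induced subgraph isomorphic to a member of $\mathcal{H}$. $\mathcal{H}_1\le\mathcal{H}_2$ means every member of $\mathcal{H}_2$ contains an induced subgraph isomorphic to some member of $\mathcal{H}_1$. A path $P$ in $G$ is isometric if it is a shortest path in $G$ between its endvertices. An isometric path cover of $G$ is a family of isometric paths of $G$ whose vertex sets cover $V(G)$; an isometric path partition is one with pairwise vertex-disjoint members. $\mathrm{ispc}(G)$, $\mathrm{ispp}(G)$ are the minimum cardinalities of an isometric path cover and partition. $K_n$: complete graph of order $n$; $K_{1,n}$: star of order $n+1$. With $A=\{x_i,y_i,z_i:1\le i\le n\}$: $F^{(1)}_n$: vertices $A\setminus\{x_i:3\le i\le n\}$, edges $x_1x_2,x_1y_1,x_1z_1$, $y_iy_{i+1},z_iz_{i+1}$ ($1\le i\le n-1$). $F^{(2)}_n$: vertices $A\setminus\{x_i:2\le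 i\le n\}$, edges $x_1y_1,x_1z_1,y_1z_1$, $y_iy_{i+1},z_iz_{i+1}$ ($1\le i\le n-1$). $F^{(4)}_n$: vertices $\{x_1,x_2\}\cup\{y_i,z_i:1\le i\le n\}$, edges $x_1y_1,x_1z_1,x_2y_1,x_2z_1$, $y_iy_{i+1},z_iz_{i+1}$ ($1\le i\le n-1$). $F^{(5)}_n$: $F^{(4)}_n$ plus the edge $x_1x_2$. -}

module Defs where

open import Data.Nat using (ℕ; zero; suc; _+_; _≤_; _<_; _≡ᵇ_)
open import Data.Fin using (Fin; zero; suc; toℕ; inject₁; fromℕ; splitAt; _≟_)
open import Data.Bool using (Bool; true; false; _∧_; _∨_; if_then_else_; not)
open import Data.Bool.Properties using (∨-comm)
open import Data.Sum using (_⊎_; inj₁; inj₂)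
open import Data.Product using (Σ; ∃; _×_; _,_)
open import Data.List using (List)
open import Data.List.Relation.Unary.All using (All)
open import Data.List.Relation.Unary.Any using (Any)
open import Relation.Nullary using (¬_; yes; no)
open import Relation.Nullary.Decidable using (⌊_⌋)
open import Relation.Binary.PropositionalEquality using (_≡_; refl; sym)
open import Data.Empty using (⊥-elim)

record Graph : Set where
  field
    size   : ℕ
    adj    : Fin size → Fin size → Bool
    adj-sym   : ∀ u v → adj u v ≡ adj v u
    adj-irrefl : ∀ u → adj u u ≡ false
open Graph public

mkGraph : (k : ℕ) → (Fin k → Fin k → Bool) → Graph
mkGraph k e = record
  { size = k
  ; adj = a
  ; adj-sym = s
  ; adj-irrefl = r
  }
  where
  a : Fin k → Fin k → Bool
  a i j = if ⌊ i ≟ j ⌋ then false else (e i j ∨ e j i)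
  s : ∀ u v → a u v ≡ a v u
  s u v with u ≟ v | v ≟ u
  ... | yes _ | yes _ = refl
  ... | yes p | no q = ⊥-elim (q (sym p))
  ... | no q | yes p = ⊥-elim (q (sym p))
  ... | no _ | no _ = ∨-comm (e u v) (e v u)
  r : ∀ u → a u u ≡ false
  r u with u ≟ u
  ... | yes _ = refl
  ... | no q = ⊥-elim (q refl)

_⊑_ : Graph → Graph → Set
H ⊑ G = Σ (Fin (size H) → Fin (size G)) λ f →
          (∀ i j → f i ≡ f j → i ≡ j) ×
          (∀ i j → adj G (f i) (f j) ≡ adj H i j)

Free : List Graph → Graph → Set
Free ℋ G = All (λ H → ¬ (H ⊑ G)) ℋ

_≼_ : List Graph → List Graph → Set
ℋ₁ ≼ ℋ₂ = All (λ H₂ → Any (λ H₁ → H₁ ⊑ H₂) ℋ₁) ℋ₂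

data Walk (G : Graph) : Fin (size G) → Fin (size G) → ℕ → Set where
  nil  : ∀ {u} → Walk G u u 0
  cons : ∀ {u w v k} → adj G u w ≡ true → Walk G w v k → Walk G u v (suc k)

Connected : Graph → Set
Connected G = (0 < size G) × (∀ u v → ∃ λ k → Walk G u v k)

record IsoPath (G : Graph) : Set where
  field
    len      : ℕ
    vert     : Fin (suc len) → Fin (size G)
    step     : ∀ (i : Fin len) → adj G (vert (inject₁ i)) (vert (suc i)) ≡ true
    distinct : ∀ i j → vert i ≡ vert j → i ≡ j
    shortest : ∀ k → Walk G (vert zero) (vert (fromℕ len)) k → len ≤ k
open IsoPath public

IsCover : (G : Graph) (m : ℕ) → (Fin m → IsoPath G) → Set
IsCover G m P = ∀ v → ∃ λ i → ∃ λ j → vert (P i) j ≡ v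

IsDisjoint : (G : Graph) (m : ℕ) → (Fin m → IsoPath G) → Set
IsDisjoint G m P = ∀ i i' j j' → vert (P i) j ≡ vert (P i') j' → i ≡ i'

IspcAtMost : Graph → ℕ → Set
IspcAtMost G c = ∃ λ m → m ≤ c × Σ (Fin m → IsoPath G) λ P → IsCover G m P

IsppAtMost : Graph → ℕ → Set
IsppAtMost G c = ∃ λ m → m ≤ c × Σ (Fin m → IsoPath G) λ P →
                   IsCover G m P × IsDisjoint G m P

K : ℕ → Graph
K n = mkGraph n (λ _ _ → true)

K1 : ℕ → Graph
K1 n = mkGraph (suc n) (λ i j → toℕ i ≡ᵇ 0)

-- Generic "two pending paths" graph on Fin ((n + n) + k):
-- indices 0..n-1 are y₁..y_n, n..2n-1 are z₁..z_n, the last k are x₁..x_k.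
-- Edges: y_i y_{i+1}, z_i z_{i+1}; y₁z₁ if yz; x_a x_b if xx a b;
-- x_a y₁ and x_a z₁ if ends a.
data Tag (n k : ℕ) : Set where
  y z : Fin n → Tag n k
  x   : Fin k → Tag n k

tag : ∀ n k → Fin ((n + n) + k) → Tag n k
tag n k v with splitAt (n + n) v
... | inj₂ a = x a
... | inj₁ w with splitAt n w
...   | inj₁ i = y i
...   | inj₂ i = z i

twoPaths : (n k : ℕ) (xx : Fin k → Fin k → Bool) (ends : Fin k → Bool) (yz : Bool) → Graph
twoPaths n k xx ends yz = mkGraph ((n + n) + k) (λ u v → e (tag n k u) (tag n k v))
  where
  e : Tag n k → Tag n k → Bool
  e (y i) (y j) = suc (toℕ i) ≡ᵇ toℕ j
  e (z i) (z j) = suc (toℕ i) ≡ᵇ toℕ j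
  e (y i) (z j) = yz ∧ (toℕ i ≡ᵇ 0) ∧ (toℕ j ≡ᵇ 0)
  e (x a) (x b) = xx a b
  e (x a) (y i) = ends a ∧ (toℕ i ≡ᵇ 0)
  e (x a) (z i) = ends a ∧ (toℕ i ≡ᵇ 0)
  e _ _ = false

F1 : ℕ → Graph
F1 n = twoPaths n 2 (λ a b → (toℕ a ≡ᵇ 0) ∧ (toℕ b ≡ᵇ 1)) (λ a → toℕ a ≡ᵇ 0) false

F2 : ℕ → Graph
F2 n = twoPaths n 1 (λ _ _ → false) (λ _ → true) true

F4 : ℕ → Graph
F4 n = twoPaths n 2 (λ _ _ → false) (λ _ → true) false

F5 : ℕ → Graph
F5 n = twoPaths n 2 (λ _ _ → true) (λ _ → true) false

{-# OPTIONS --safe #-}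

-- Sufficiency. Root G anywhere and let P be a path descending through the distance layers. By F¹ and F²
-- a vertex adjacent to the middle of P, in layer k say, is adjacent to both P(k-1) and P(k+1), so it can
-- replace P(k). Applying this to the modified paths as well, the vertices parallel to the middle of P are closed under
-- adjacency, and consecutive layers of them are completely joined. By Ramsey's theorem degrees are bounded,
-- so boundedly many paths P, one for each vertex of a fixed layer, account for all but boundedly many vertices;
-- around each of them boundedly many layered, hence isometric, paths suffice. If F⁴ and F⁵ are excluded too, the
-- only parallel vertices are those of P, and the paths P are disjoint as branches of one tree.
--
-- Necessity. A vertex whose neighbours are pairwise adjacent can only be an end of an isometric path.
-- This bounds from below the covers of Kₙ, of K₁,ₙ and of long paths with many widely spaced pendant vertices
-- or triangles, in which small connected induced subgraphs lie in F¹ₙ or F²ₙ. For partitions the same works with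
-- twins instead: of two vertices with the same two ways through, one is an end.
module Submission where

open import Defs
open import Data.Bool using (Bool; true; false; _∨_; _∧_; T)
import Data.Bool.Properties as Bool
open import Data.Empty using (⊥; ⊥-elim)
open import Data.Fin using (Fin; zero; suc; toℕ; _≟_; splitAt; _↑ˡ_; _↑ʳ_; fromℕ<; fromℕ; inject₁; join; combine)
open import Data.Fin.Properties using (any?; all?; toℕ<n; toℕ-injective; injective⇒≤; toℕ-fromℕ<; splitAt-↑ˡ; splitAt-↑ʳ; splitAt⁻¹-↑ˡ; splitAt⁻¹-↑ʳ; toℕ-fromℕ; toℕ-inject₁; combine-injective; splitAt-join; join-splitAt)
open import Data.List using (List; []; _∷_; _++_; length; filter; allFin; concatMap; lookup; map; upTo; deduplicate)
open import Data.List.Extrema.Nat using (argmax; argmax-all; f[xs]≤f[argmax])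
open import Data.List.Membership.Propositional using (_∈_; lose; find)
open import Data.List.Membership.Propositional.Properties using (∈-filter⁺; ∈-filter⁻; ∈-allFin; ∈-concatMap⁺; ∈-++⁺ˡ; ∈-++⁺ʳ; ∈-lookup; ∈-deduplicate⁺; ∈-upTo⁺; ∈-map⁺)
open import Data.List.Properties using (length-++; length-filter; length-map; length-upTo; length-deduplicate)
open import Data.List.Relation.Binary.Subset.Propositional using (_⊆_)
import Data.List.Relation.Unary.All as All
open import Data.List.Relation.Unary.All using (All; []; _∷_)
import Data.List.Relation.Unary.All.Properties as All
open import Data.List.Relation.Unary.All.Properties using (¬Any⇒All¬)
import Data.List.Relation.Unary.AllPairs as AllPairs
open import Data.List.Relation.Unary.AllPairs using (AllPairs; []; _∷_)
import Data.List.Relation.Unary.AllPairs.Properties as AllPairs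
import Data.List.Relation.Unary.Any as Any
open import Data.List.Relation.Unary.Any using (Any; here; there)
import Data.List.Relation.Unary.Any.Properties as Any
open import Data.List.Relation.Unary.Unique.DecPropositional.Properties using (deduplicate-!)
open import Data.List.Relation.Unary.Unique.Propositional using (Unique)
import Data.List.Relation.Unary.Unique.Propositional.Properties as Unique
open import Data.Maybe using (Maybe; just; nothing)
open import Data.Maybe.Properties using (just-injective)
import Data.Nat as ℕ
open import Data.Nat using (ℕ; zero; suc; pred; _+_; _∸_; _≤_; _<_; z≤n; s≤s; _≤?_; _≡ᵇ_; _*_; _^_; _<?_)
open import Data.Nat.ListAction using (sum)
open import Data.Nat.Properties hiding (_≟_)
open import Data.Product using (∃; _×_; _,_; proj₁; proj₂)
open import Data.Sum using (_⊎_; inj₁; inj₂; [_,_]′; swap)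
open import Data.Sum.Properties using (inj₁-injective; inj₂-injective)
open import Data.Vec.Functional using () renaming (_∷_ to _∷ᶠ_)
open import Function.Bundles using (_⇔_; mk⇔; Equivalence)
open import Relation.Binary.PropositionalEquality
open import Relation.Nullary using (¬_; Dec; yes; no; contradiction; ¬?; does)
open import Relation.Nullary.Decidable using (map′; _×-dec_; _→-dec_; _⊎-dec_; dec-true)
open import Relation.Unary using (Decidable)

-- A vertex off a layered path can see only three consecutive positions of it, and up to reflection
-- `F1`, `F2`, `F4` and `F5` are the four ways of seeing at least one. This is why one notion,
-- `Pattern`, serves both halves: a bad vertex next to a long path shows an induced F, and the same
-- pattern repeated along a path gives the graphs without small covers or partitions. The obstacle
-- to sufficiency is branching: a vertex at distance two from P might lead away from it. But a
-- neighbour of a parallel vertex is controlled by the modified path, and it also has a neighbour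
-- among the unmodified vertices of P, so P itself controls it. Hence all descendants of one vertex
-- of layer 4 + n stay with one path, except close to its deep end. That path is taken to a deepest
-- descendant, so only boundedly many layers lie past the controlled part. In the necessity half n
-- exceeds both 2c and the order of every member of the family, so that a member found in a comb is
-- too small to see two of its teeth.

V : Graph → Set
V G = Fin (size G)

Adj : (G : Graph) → V G → V G → Set
Adj G u v = adj G u v ≡ true

module _ (G : Graph) where

  Adj? : ∀ u v → Dec (Adj G u v)
  Adj? u v = adj G u v Bool.≟ true

  Adj-sym : ∀ {u v} → Adj G u v → Adj G v u
  Adj-sym {u} {v} a = trans (adj-sym G v u) a

  Adj⇒≢ : ∀ {u v} → Adj G u v → u ≢ v
  Adj⇒≢ {u} a refl with () ← trans (sym a) (adj-irrefl G u)

mkGraph-adj : ∀ {k e} {i j : Fin k} → i ≢ j → adj (mkGraph k e) i j ≡ e i j ∨ e j i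
mkGraph-adj {i = i} {j} i≢j with i ≟ j
... | yes i≡j = contradiction i≡j i≢j
... | no _ = refl

∨-true⁻ : ∀ {a b} → a ∨ b ≡ true → a ≡ true ⊎ b ≡ true
∨-true⁻ {true} _ = inj₁ refl
∨-true⁻ {false} eq = inj₂ eq

∨-true⁺ : ∀ {a b} → a ≡ true ⊎ b ≡ true → a ∨ b ≡ true
∨-true⁺ {true} _ = refl
∨-true⁺ {false} (inj₂ eq) = eq

-- Induced subgraphs and their decidability

⊑-trans : ∀ {A B C} → A ⊑ B → B ⊑ C → A ⊑ C
⊑-trans (f , f-inj , f-adj) (g , g-inj , g-adj) =
  (λ i → g (f i)) , (λ i j eq → f-inj i j (g-inj _ _ eq)) , λ i j → trans (g-adj _ _) (f-adj i j)

-- A function on `Fin (suc a)` is a value at zero followed by a function on the rest, so the search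
-- recurses on `a`. A function rebuilt in this way agrees with the original only pointwise, which is
-- why `P` has to respect pointwise equality.
any-function? : ∀ {a b} {P : (Fin a → Fin b) → Set} →
  (∀ {f g} → (∀ i → f i ≡ g i) → P f → P g) → (∀ f → Dec (P f)) → Dec (∃ P)
any-function? {zero} resp P? = map′ (λ p → _ , p) (λ (_ , p) → resp (λ ()) p) (P? λ ())
any-function? {suc a} {P = P} resp P? =
  map′ (λ (b , f , p) → b ∷ᶠ f , p)
       (λ (f , p) → f zero , (λ i → f (suc i)) , resp (λ { zero → refl ; (suc _) → refl }) p)
       (any? λ b → any-function? {P = λ f → P (b ∷ᶠ f)}
         (λ eq → resp λ { zero → refl ; (suc i) → eq i }) λ f → P? (b ∷ᶠ f))

IsEmbedding : ∀ H G → (V H → V G) → Set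
IsEmbedding H G f = (∀ i j → f i ≡ f j → i ≡ j) × (∀ i j → adj G (f i) (f j) ≡ adj H i j)

IsEmbedding-cong : ∀ {H G f g} → (∀ i → f i ≡ g i) → IsEmbedding H G f → IsEmbedding H G g
IsEmbedding-cong {G = G} eq (inj , ad) =
  (λ i j e → inj i j (trans (eq i) (trans e (sym (eq j))))) ,
  λ i j → trans (cong₂ (adj G) (sym (eq i)) (sym (eq j))) (ad i j)

_⊑?_ : ∀ H G → Dec (H ⊑ G)
H ⊑? G = any-function? {P = IsEmbedding H G} (IsEmbedding-cong {H} {G}) λ f →
  (all? λ i → all? λ j → (f i ≟ f j) →-dec (i ≟ j)) ×-dec
  (all? λ i → all? λ j → adj G (f i) (f j) Bool.≟ adj H i j)

-- For the necessity half: boundedness merely refutes freeness, and the finite search turns the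
-- refutation into a member of the family.
¬Free⇒Any⊑ : ∀ {ℋ G} → ¬ Free ℋ G → Any (_⊑ G) ℋ
¬Free⇒Any⊑ {ℋ} {G} ¬free with Any.any? (_⊑? G) ℋ
... | yes a = a
... | no ¬a = contradiction (¬Any⇒All¬ ℋ ¬a) ¬free

-- Walks and distance layers

least : {P : ℕ → Set} → (∀ k → Dec (P k)) → ∀ k → P k → ∃ λ m → P m × (∀ j → P j → m ≤ j)
least P? zero p = 0 , p , λ _ _ → z≤n
least {P} P? (suc k) p with P? 0
... | yes p₀ = 0 , p₀ , λ _ _ → z≤n
... | no ¬p₀ with m , pm , min ← least {λ i → P (suc i)} (λ i → P? (suc i)) k p =
  suc m , pm , λ { zero p₀ → contradiction p₀ ¬p₀ ; (suc j) pj → s≤s (min j pj) }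

module _ {G : Graph} where

  walk? : ∀ u v k → Dec (Walk G u v k)
  walk? u v zero = map′ (λ { refl → nil }) (λ { nil → refl }) (u ≟ v)
  walk? u v (suc k) = map′ (λ (_ , a , w) → cons a w) (λ { (cons a w) → _ , a , w })
    (any? λ w → Adj? G u w ×-dec walk? w v k)

  infixr 5 _++ʷ_
  _++ʷ_ : ∀ {u v w j k} → Walk G u v j → Walk G v w k → Walk G u w (j + k)
  nil ++ʷ q = q
  cons a p ++ʷ q = cons a (p ++ʷ q)

  -- One inequality suffices: adjacency is symmetric, so the change along an edge is bounded in both
  -- directions.
  Lipschitz : (V G → ℕ) → Set
  Lipschitz g = ∀ {u v} → Adj G u v → g u ≤ suc (g v)

  walk-lipschitz : ∀ g → Lipschitz g → ∀ {u v k} → Walk G u v k → g u ≤ k + g v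
  walk-lipschitz g lip nil = ≤-refl
  walk-lipschitz g lip (cons a w) = ≤-trans (lip a) (s≤s (walk-lipschitz g lip w))

module Rooted (G : Graph) (connected : Connected G) (r : V G) where

  abstract
    shortest-walk : ∀ v → ∃ λ k → Walk G v r k × (∀ j → Walk G v r j → k ≤ j)
    shortest-walk v = least (walk? v r) _ (proj₂ (proj₂ connected v r))

  depth : V G → ℕ
  depth v = proj₁ (shortest-walk v)

  depth-walk : ∀ v → Walk G v r (depth v)
  depth-walk v = proj₁ (proj₂ (shortest-walk v))

  depth-min : ∀ {v k} → Walk G v r k → depth v ≤ k
  depth-min {v} w = proj₂ (proj₂ (shortest-walk v)) _ w

  depth-lipschitz : Lipschitz {G} depth
  depth-lipschitz {v = v} a = depth-min (cons a (depth-walk v))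

  private
    parent-of : ∀ {v k} → Walk G v r k → V G
    parent-of nil = r
    parent-of (cons {w = w} _ _) = w

    parent-of-adj : ∀ {v k} (w : Walk G v r k) → 0 < k → Adj G v (parent-of w)
    parent-of-adj (cons a _) _ = a

    parent-of-walk : ∀ {v k} (w : Walk G v r k) → Walk G (parent-of w) r (pred k)
    parent-of-walk nil = nil
    parent-of-walk (cons _ w) = w

  -- Read off one fixed shortest walk per vertex, so the parents form a breadth-first tree; the root
  -- is its own parent.
  parent : V G → V G
  parent v = parent-of (depth-walk v)

  parent-adj : ∀ v → 0 < depth v → Adj G v (parent v)
  parent-adj v = parent-of-adj (depth-walk v)

  depth-parent : ∀ v → depth (parent v) ≡ pred (depth v)
  depth-parent v = ≤-antisym (depth-min (parent-of-walk (depth-walk v))) (lower (depth v) refl)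
    where
    lower : ∀ k → depth v ≡ k → pred (depth v) ≤ depth (parent v)
    lower zero eq = subst (λ d → pred d ≤ depth (parent v)) (sym eq) z≤n
    lower (suc k) eq = pred-mono-≤ (depth-lipschitz (parent-adj v (subst (0 <_) (sym eq) (s≤s z≤n))))

  ancestor : ℕ → V G → V G
  ancestor zero v = v
  ancestor (suc j) v = parent (ancestor j v)

  depth-ancestor : ∀ j v → depth (ancestor j v) ≡ depth v ∸ j
  depth-ancestor zero v = refl
  depth-ancestor (suc j) v = trans (depth-parent (ancestor j v))
    (trans (cong pred (depth-ancestor j v)) (pred[m∸n]≡m∸[1+n] (depth v) j))

  ancestor-+ : ∀ i j v → ancestor (i + j) v ≡ ancestor i (ancestor j v)
  ancestor-+ zero j v = refl
  ancestor-+ (suc i) j v = cong parent (ancestor-+ i j v)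

  -- The ancestors of `v` lie in different layers and so are distinct vertices. This later confines
  -- a small connected graph to a short window of a comb.
  depth<size : ∀ v → depth v < size G
  depth<size v = injective⇒≤ {f = λ (i : Fin (suc (depth v))) → ancestor (toℕ i) v} inj
    where
    inj : ∀ {i j : Fin (suc (depth v))} → ancestor (toℕ i) v ≡ ancestor (toℕ j) v → i ≡ j
    inj {i} {j} eq = toℕ-injective (∸-cancelˡ-≡ (≤-pred (toℕ<n i)) (≤-pred (toℕ<n j))
      (trans (sym (depth-ancestor (toℕ i) v)) (trans (cong depth eq) (depth-ancestor (toℕ j) v))))

  -- `at` is total so that positions can be shifted by plain arithmetic; its values beyond `m` carry
  -- no meaning.
  record Layered (m : ℕ) : Set where
    field
      at    : ℕ → V G
      layer : ∀ {i} → i ≤ m → depth (at i) ≡ i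
      link  : ∀ {i} → i < m → Adj G (at i) (at (suc i))

  chain : ∀ v → Layered (depth v)
  chain v = record
    { at = λ i → ancestor (depth v ∸ i) v
    ; layer = λ {i} i≤m → trans (depth-ancestor (depth v ∸ i) v) (m∸[m∸n]≡n i≤m)
    ; link = λ {i} i<m → Adj-sym G (subst (λ j → Adj G (ancestor (depth v ∸ suc i) v) (ancestor j v))
        (sym (+-∸-assoc 1 i<m))
        (parent-adj _ (subst (0 <_) (sym (trans (depth-ancestor (depth v ∸ suc i) v) (m∸[m∸n]≡n i<m))) (s≤s z≤n))))
    }

-- The graphs F as a path with one extra vertex

-- A path through the positions 0, 1, 2, … (just i) together with one extra vertex (nothing),
-- whose neighbours are those among c - 1, c, c + 1 that the pattern selects.
record Pattern : Set where
  constructor selecting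
  field
    lo mid hi : Bool
open Pattern

module _ (π : Pattern) (c : ℕ) where

  Touch : ℕ → Set
  Touch i = (lo π ≡ true × suc i ≡ c) ⊎ (mid π ≡ true × i ≡ c) ⊎ (hi π ≡ true × i ≡ suc c)

  Link : Maybe ℕ → Maybe ℕ → Set
  Link (just i) (just j) = suc i ≡ j ⊎ suc j ≡ i
  Link nothing (just j) = Touch j
  Link (just i) nothing = Touch i
  Link nothing nothing = ⊥

  Link-sym : ∀ {s t} → Link s t → Link t s
  Link-sym {just i} {just j} = swap
  Link-sym {just i} {nothing} t = t
  Link-sym {nothing} {just j} t = t

  Link-irrefl : ∀ {s} → ¬ Link s s
  Link-irrefl {just i} (inj₁ eq) = 1+n≢n eq
  Link-irrefl {just i} (inj₂ eq) = 1+n≢n eq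

-- The path of `F1`, `F4` and `F5` has positions 0 to 2n, that of `F2` only 0 to 2n - 1. Hence
-- positions are at most `n + n`, but only those below `n + n` are promised to be occupied. The
-- bound is for embedding F into a graph, the occupancy for embedding a graph into F.
record Realisation (n : ℕ) (π : Pattern) (F : Graph) : Set where
  field
    place         : V F → Maybe ℕ
    place-inj     : ∀ {u v} → place u ≡ place v → u ≡ v
    place-adj     : ∀ {u v} → Adj F u v ⇔ Link π n (place u) (place v)
    place-bound   : ∀ {u i} → place u ≡ just i → i ≤ n + n
    onto-position : ∀ {i} → i < n + n → ∃ λ u → place u ≡ just i
    onto-apex     : ∃ λ u → place u ≡ nothing

≡ᵇ⁻ : ∀ {i j} → (i ≡ᵇ j) ≡ true → i ≡ j
≡ᵇ⁻ {i} {j} eq = ≡ᵇ⇒≡ i j (subst T (sym eq) _)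

≡ᵇ⁺ : ∀ {i j} → i ≡ j → (i ≡ᵇ j) ≡ true
≡ᵇ⁺ {i} {j} eq = Equivalence.to Bool.T-≡ (≡⇒≡ᵇ i j eq)

∧-true⁻ : ∀ {a b} → a ∧ b ≡ true → a ≡ true × b ≡ true
∧-true⁻ {true} eq = refl , eq

module _ (n k : ℕ) where

  untag : Tag n k → Fin ((n + n) + k)
  untag (y i) = (i ↑ˡ n) ↑ˡ k
  untag (z i) = (n ↑ʳ i) ↑ˡ k
  untag (x a) = (n + n) ↑ʳ a

  untag-tag : ∀ v → untag (tag n k v) ≡ v
  untag-tag v with splitAt (n + n) v in eq
  ... | inj₂ a = splitAt⁻¹-↑ʳ eq
  ... | inj₁ w with splitAt n w in eq′
  ...   | inj₁ i = trans (cong (_↑ˡ k) (splitAt⁻¹-↑ˡ eq′)) (splitAt⁻¹-↑ˡ eq)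
  ...   | inj₂ i = trans (cong (_↑ˡ k) (splitAt⁻¹-↑ʳ {n} eq′)) (splitAt⁻¹-↑ˡ eq)

  tag-untag : ∀ t → tag n k (untag t) ≡ t
  tag-untag (y i) rewrite splitAt-↑ˡ (n + n) (i ↑ˡ n) k | splitAt-↑ˡ n i n = refl
  tag-untag (z i) rewrite splitAt-↑ˡ (n + n) (n ↑ʳ i) k | splitAt-↑ʳ n n i = refl
  tag-untag (x a) rewrite splitAt-↑ʳ (n + n) k a = refl

  module _ (xx : Fin k → Fin k → Bool) (ends : Fin k → Bool) (yz : Bool) where

    -- The edge function of `twoPaths` is local and cannot be named here; this is a copy, and
    -- `twoPaths-adj` checks the agreement for every pair of tags.
    edge : Tag n k → Tag n k → Bool
    edge (y i) (y j) = suc (toℕ i) ≡ᵇ toℕ j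
    edge (z i) (z j) = suc (toℕ i) ≡ᵇ toℕ j
    edge (y i) (z j) = yz ∧ (toℕ i ≡ᵇ 0) ∧ (toℕ j ≡ᵇ 0)
    edge (x a) (x b) = xx a b
    edge (x a) (y i) = ends a ∧ (toℕ i ≡ᵇ 0)
    edge (x a) (z i) = ends a ∧ (toℕ i ≡ᵇ 0)
    edge _ _ = false

    twoPaths-adj : ∀ {u v} → u ≢ v →
      adj (twoPaths n k xx ends yz) u v ≡ edge (tag n k u) (tag n k v) ∨ edge (tag n k v) (tag n k u)
    twoPaths-adj {u} {v} u≢v with u ≟ v
    ... | yes u≡v = contradiction u≡v u≢v
    ... | no _ with tag n k u | tag n k v
    ...   | y _ | y _ = refl
    ...   | y _ | z _ = refl
    ...   | y _ | x _ = refl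
    ...   | z _ | y _ = refl
    ...   | z _ | z _ = refl
    ...   | z _ | x _ = refl
    ...   | x _ | y _ = refl
    ...   | x _ | z _ = refl
    ...   | x _ | x _ = refl

    -- The legs y and z are laid out to the left and to the right of the middle; when y₁ and z₁ are
    -- not adjacent, position n between them (off = 1) is taken by one of the x's.
    record Layout (π : Pattern) (off : ℕ) : Set where
      field
        yz-off  : (yz ≡ true × off ≡ 0) ⊎ (yz ≡ false × off ≡ 1)
        place-x : Fin k → Maybe ℕ
        x-inj   : ∀ {a b} → place-x a ≡ place-x b → a ≡ b
        x-range : ∀ {a i} → place-x a ≡ just i → i ≡ n × off ≡ 1
        x-apex  : ∃ λ a → place-x a ≡ nothing
        x-mid   : off ≡ 1 → ∃ λ a → place-x a ≡ just n
        xx⁺     : ∀ {a b} → a ≢ b → xx a b ≡ true → Link π n (place-x a) (place-x b)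
        xx⁻     : ∀ {a b} → Link π n (place-x a) (place-x b) → xx a b ≡ true ⊎ xx b a ≡ true
        xy⁺     : ∀ {a i} → ends a ≡ true → suc i ≡ n → Link π n (place-x a) (just i)
        xy⁻     : ∀ {a i} → i < n → Link π n (place-x a) (just i) → ends a ≡ true × suc i ≡ n
        xz⁺     : ∀ {a i} → ends a ≡ true → i ≡ off + n → Link π n (place-x a) (just i)
        xz⁻     : ∀ {a i} → off + n ≤ i → Link π n (place-x a) (just i) → ends a ≡ true × i ≡ off + n

    module _ {π : Pattern} {off : ℕ} (layout : Layout π off) where
      open Layout layout

      left right : Fin n → ℕ
      left i = n ∸ suc (toℕ i)
      right i = off + (n + toℕ i)

      left-+ : ∀ i → left i + suc (toℕ i) ≡ n
      left-+ i = m∸n+n≡m (toℕ<n i)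

      left< : ∀ i → left i < n
      left< i = ∸-monoʳ-< {n} (s≤s z≤n) (toℕ<n i)

      ≤right : ∀ i → off + n ≤ right i
      ≤right i = +-monoʳ-≤ off (m≤m+n n (toℕ i))

      n≤right : ∀ i → n ≤ right i
      n≤right i = ≤-trans (m≤n+m n off) (≤right i)

      position : Tag n k → Maybe ℕ
      position (y i) = just (left i)
      position (z i) = just (right i)
      position (x a) = place-x a

      x≢left : ∀ {a i} → place-x a ≢ just (left i)
      x≢left {i = i} eq = <⇒≢ (left< i) (proj₁ (x-range eq))

      x≢right : ∀ {a i} → place-x a ≢ just (right i)
      x≢right {i = i} eq with r , refl ← x-range eq =
        <⇒≢ (s≤s (m≤m+n n (toℕ i))) (sym r)

      position-inj : ∀ s t → position s ≡ position t → s ≡ t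
      position-inj (y i) (y j) eq = cong y (toℕ-injective (suc-injective
        (∸-cancelˡ-≡ (toℕ<n i) (toℕ<n j) (just-injective eq))))
      position-inj (y i) (z j) eq = contradiction (just-injective eq) (<⇒≢ (<-≤-trans (left< i) (n≤right j)))
      position-inj (y i) (x a) eq = contradiction (sym eq) x≢left
      position-inj (z i) (y j) eq = contradiction (sym (just-injective eq)) (<⇒≢ (<-≤-trans (left< j) (n≤right i)))
      position-inj (z i) (z j) eq = cong z (toℕ-injective (+-cancelˡ-≡ n _ _ (+-cancelˡ-≡ off _ _ (just-injective eq))))
      position-inj (z i) (x a) eq = contradiction (sym eq) x≢right
      position-inj (x a) (y i) eq = contradiction eq x≢left
      position-inj (x a) (z i) eq = contradiction eq x≢right
      position-inj (x a) (x b) eq = cong x (x-inj eq)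

      left-0 : ∀ i → toℕ i ≡ 0 → suc (left i) ≡ n
      left-0 i eq = trans (+-comm 1 (left i)) (trans (cong (λ j → left i + suc j) (sym eq)) (left-+ i))

      left-0⁻ : ∀ i → suc (left i) ≡ n → toℕ i ≡ 0
      left-0⁻ i eq = suc-injective (+-cancelˡ-≡ (left i) _ _ (trans (left-+ i) (trans (sym eq) (+-comm 1 (left i)))))

      right-0 : ∀ i → toℕ i ≡ 0 → right i ≡ off + n
      right-0 i eq = cong (off +_) (trans (cong (n +_) eq) (+-identityʳ n))

      right-0⁻ : ∀ i → right i ≡ off + n → toℕ i ≡ 0
      right-0⁻ i eq = +-cancelˡ-≡ n _ _ (trans (+-cancelˡ-≡ off _ _ eq) (sym (+-identityʳ n)))

      edge⇒Link : ∀ s t → s ≢ t → edge s t ≡ true → Link π n (position s) (position t)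
      edge⇒Link (y i) (y j) _ e = inj₂ (+-cancelʳ-≡ (toℕ j) _ _
        (trans (sym (+-suc (left j) (toℕ j)))
          (trans (left-+ j) (trans (sym (left-+ i)) (cong (left i +_) (≡ᵇ⁻ e))))))
      edge⇒Link (z i) (z j) _ e = inj₁ (trans (sym (+-suc off (n + toℕ i)))
        (cong (off +_) (trans (sym (+-suc n (toℕ i))) (cong (n +_) (≡ᵇ⁻ e)))))
      edge⇒Link (y i) (z j) _ e with yz-off
      ... | inj₁ (refl , refl) with ei , ej ← ∧-true⁻ {toℕ i ≡ᵇ 0} e =
        inj₁ (trans (left-0 i (≡ᵇ⁻ ei)) (sym (right-0 j (≡ᵇ⁻ ej))))
      ... | inj₂ (refl , _) with () ← e
      edge⇒Link (x a) (x b) s≢t e = xx⁺ (λ eq → s≢t (cong x eq)) e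
      edge⇒Link (x a) (y i) _ e with ea , ei ← ∧-true⁻ {ends a} e = xy⁺ ea (left-0 i (≡ᵇ⁻ ei))
      edge⇒Link (x a) (z i) _ e with ea , ei ← ∧-true⁻ {ends a} e = xz⁺ ea (right-0 i (≡ᵇ⁻ ei))

      left-right : ∀ i j → suc (left i) ≡ right j ⊎ suc (right j) ≡ left i → edge (y i) (z j) ≡ true
      left-right i j (inj₂ eq) = contradiction eq (>⇒≢ (m≤n⇒m≤1+n (<-≤-trans (left< i) (n≤right j))))
      left-right i j (inj₁ eq) with yz-off
      ... | inj₁ (refl , refl) = cong₂ _∧_ (≡ᵇ⁺ (left-0⁻ i l)) (≡ᵇ⁺ (right-0⁻ j (trans (sym eq) l)))
        where
        l : suc (left i) ≡ n
        l = ≤-antisym (left< i) (≤-trans (n≤right j) (≤-reflexive (sym eq)))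
      ... | inj₂ (_ , refl) = contradiction eq (<⇒≢ (s≤s (<-≤-trans (left< i) (m≤m+n n (toℕ j)))))

      x-left : ∀ a i → Link π n (place-x a) (just (left i)) → edge (x a) (y i) ≡ true
      x-left a i l with ea , eq ← xy⁻ (left< i) l = cong₂ _∧_ ea (≡ᵇ⁺ (left-0⁻ i eq))

      x-right : ∀ a i → Link π n (place-x a) (just (right i)) → edge (x a) (z i) ≡ true
      x-right a i l with ea , eq ← xz⁻ (≤right i) l = cong₂ _∧_ ea (≡ᵇ⁺ (right-0⁻ i eq))

      Link⇒edge : ∀ s t → Link π n (position s) (position t) → edge s t ≡ true ⊎ edge t s ≡ true
      Link⇒edge (y i) (y j) (inj₁ eq) = inj₂ (≡ᵇ⁺ (+-cancelˡ-≡ (left j) _ _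
        (trans (left-+ j) (trans (sym (left-+ i)) (trans (+-suc (left i) (toℕ i)) (cong (_+ toℕ i) eq))))))
      Link⇒edge (y i) (y j) (inj₂ eq) = inj₁ (≡ᵇ⁺ (+-cancelˡ-≡ (left i) _ _
        (trans (left-+ i) (trans (sym (left-+ j)) (trans (+-suc (left j) (toℕ j)) (cong (_+ toℕ j) eq))))))
      Link⇒edge (y i) (z j) l = inj₁ (left-right i j l)
      Link⇒edge (z j) (y i) l = inj₂ (left-right i j (swap l))
      Link⇒edge (z i) (z j) (inj₁ eq) = inj₁ (≡ᵇ⁺ (+-cancelˡ-≡ n _ _ (+-cancelˡ-≡ off _ _
        (trans (cong (off +_) (+-suc n (toℕ i))) (trans (+-suc off (n + toℕ i)) eq)))))
      Link⇒edge (z i) (z j) (inj₂ eq) = inj₂ (≡ᵇ⁺ (+-cancelˡ-≡ n _ _ (+-cancelˡ-≡ off _ _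
        (trans (cong (off +_) (+-suc n (toℕ j))) (trans (+-suc off (n + toℕ j)) eq)))))
      Link⇒edge (x a) (x b) l = xx⁻ l
      Link⇒edge (x a) (y i) l = inj₁ (x-left a i l)
      Link⇒edge (x a) (z i) l = inj₁ (x-right a i l)
      Link⇒edge (y i) (x a) l = inj₂ (x-left a i (Link-sym π n {just (left i)} {place-x a} l))
      Link⇒edge (z i) (x a) l = inj₂ (x-right a i (Link-sym π n {just (right i)} {place-x a} l))

      private
        G : Graph
        G = twoPaths n k xx ends yz

        tag-inj : ∀ {u v} → tag n k u ≡ tag n k v → u ≡ v
        tag-inj {u} {v} eq = trans (sym (untag-tag u)) (trans (cong untag eq) (untag-tag v))

        pos : V G → Maybe ℕ
        pos u = position (tag n k u)

        adj⇒ : ∀ {u v} → Adj G u v → Link π n (pos u) (pos v)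
        adj⇒ {u} {v} a = [ edge⇒Link _ _ s≢t , (λ e → Link-sym π n {pos v} {pos u} (edge⇒Link _ _ (λ eq → s≢t (sym eq)) e)) ]′
            (∨-true⁻ (trans (sym (twoPaths-adj u≢v)) a))
          where
          u≢v : u ≢ v
          u≢v = Adj⇒≢ G a
          s≢t : tag n k u ≢ tag n k v
          s≢t eq = u≢v (tag-inj eq)

        ⇒adj : ∀ {u v} → Link π n (pos u) (pos v) → Adj G u v
        ⇒adj {u} {v} l = trans (twoPaths-adj u≢v) (∨-true⁺ (Link⇒edge (tag n k u) (tag n k v) l))
          where
          u≢v : u ≢ v
          u≢v refl = Link-irrefl π n {pos u} l

        bound : ∀ t {i} → position t ≡ just i → i ≤ n + n
        bound (y i) refl = ≤-trans (<⇒≤ (left< i)) (m≤m+n n n)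
        bound (z i) refl = [ (λ { (_ , refl) → +-monoʳ-≤ n (<⇒≤ (toℕ<n i)) })
                           , (λ { (_ , refl) → ≤-trans (≤-reflexive (sym (+-suc n (toℕ i)))) (+-monoʳ-≤ n (toℕ<n i)) }) ]′ yz-off
        bound (x a) eq with refl , _ ← x-range eq = m≤m+n n n

        onto-tag : ∀ {i} → i < n + n → ∃ λ t → position t ≡ just i
        onto-tag {i} i< with i <? n
        ... | yes i<n = y j , cong just (trans (cong (λ m → n ∸ suc m) (toℕ-fromℕ< (m∸n<m i<n)))
                (trans (cong (n ∸_) (sym (+-∸-assoc 1 i<n))) (m∸[m∸n]≡n (<⇒≤ i<n))))
          where
          m∸n<m : ∀ {i n} → i < n → n ∸ suc i < n
          m∸n<m {i} {suc n} _ = s≤s (m∸n≤m n i)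
          j : Fin n
          j = fromℕ< (m∸n<m i<n)
        ... | no i≮n with yz-off
        ...   | inj₁ (_ , refl) = z (fromℕ< {i ∸ n} (small)) , cong just (trans (cong (n +_) (toℕ-fromℕ< small)) (m+[n∸m]≡n (≮⇒≥ i≮n)))
          where
          small : i ∸ n < n
          small = subst (i ∸ n <_) (m+n∸m≡n n n) (∸-monoˡ-< i< (≮⇒≥ i≮n))
        ...   | inj₂ (_ , refl) with m≤n⇒m<n∨m≡n (≮⇒≥ i≮n)
        ...     | inj₂ refl = let a , eq = x-mid refl in x a , eq
        ...     | inj₁ n<i = z (fromℕ< {i ∸ suc n} small) , cong just (trans (cong (λ m → suc (n + m)) (toℕ-fromℕ< small)) (m+[n∸m]≡n n<i))
          where
          small : i ∸ suc n < n
          small = <-≤-trans (∸-monoˡ-< i< n<i) (≤-trans (∸-monoʳ-≤ (n + n) (n≤1+n n)) (≤-reflexive (m+n∸m≡n n n)))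

      realisation : Realisation n π G
      realisation = record
        { place = pos
        ; place-inj = λ eq → tag-inj (position-inj _ _ eq)
        ; place-adj = mk⇔ adj⇒ ⇒adj
        ; place-bound = λ {u} → bound (tag n k u)
        ; onto-position = λ i< → let t , eq = onto-tag i< in untag t , trans (cong position (tag-untag t)) eq
        ; onto-apex = let a , eq = x-apex in untag (x a) , trans (cong position (tag-untag (x a))) eq
        }

onlyMid loMid loHi allThree : Pattern
onlyMid = selecting false true false
loMid = selecting true true false
loHi = selecting true false true
allThree = selecting true true true

module _ (n : ℕ) where

  -- One x joins the two legs into a single path and the other is the extra vertex. In `F1` the
  -- latter is the pendant vertex; in `F4` and `F5` the two are twins.
  centre-apex : Fin 2 → Maybe ℕ
  centre-apex zero = just n
  centre-apex (suc zero) = nothing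

  centre-apex-inj : ∀ {a b} → centre-apex a ≡ centre-apex b → a ≡ b
  centre-apex-inj {zero} {zero} _ = refl
  centre-apex-inj {zero} {suc zero} ()
  centre-apex-inj {suc zero} {suc zero} _ = refl

  centre-apex-range : ∀ {a i} → centre-apex a ≡ just i → i ≡ n × 1 ≡ 1
  centre-apex-range {zero} refl = refl , refl
  centre-apex-range {suc zero} ()

  F1-realisation : Realisation n onlyMid (F1 n)
  F1-realisation = realisation n 2 _ _ _ {onlyMid} {1} record
    { yz-off = inj₂ (refl , refl)
    ; place-x = centre-apex
    ; x-inj = centre-apex-inj
    ; x-range = centre-apex-range
    ; x-apex = suc zero , refl
    ; x-mid = λ _ → zero , refl
    ; xx⁺ = λ { {zero} {zero} a≢b _ → contradiction refl a≢b
              ; {zero} {suc zero} _ _ → inj₂ (inj₁ (refl , refl)) ; {suc zero} {zero} _ () ; {suc zero} {suc zero} a≢b _ → contradiction refl a≢b }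
    ; xx⁻ = λ { {zero} {zero} l → contradiction l (Link-irrefl onlyMid n {just n})
              ; {zero} {suc zero} _ → inj₁ refl ; {suc zero} {zero} _ → inj₂ refl ; {suc zero} {suc zero} () }
    ; xy⁺ = λ { {zero} _ eq → inj₂ eq ; {suc zero} () _ }
    ; xy⁻ = λ { {zero} i<n (inj₁ refl) → contradiction i<n (<-asym ≤-refl)
              ; {zero} _ (inj₂ eq) → refl , eq
              ; {suc zero} i<n (inj₂ (inj₁ (_ , refl))) → contradiction i<n (<-irrefl refl) }
    ; xz⁺ = λ { {zero} _ eq → inj₁ (sym eq) ; {suc zero} () _ }
    ; xz⁻ = λ { {zero} _ (inj₁ eq) → refl , sym eq
              ; {zero} n<i (inj₂ refl) → contradiction n<i (<-asym ≤-refl)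
              ; {suc zero} n<i (inj₂ (inj₁ (_ , refl))) → contradiction n<i (<-irrefl refl) }
    }

  F2-realisation : Realisation n loMid (F2 n)
  F2-realisation = realisation n 1 _ _ _ {loMid} {0} record
    { yz-off = inj₁ (refl , refl)
    ; place-x = λ _ → nothing
    ; x-inj = λ { {zero} {zero} _ → refl }
    ; x-range = λ ()
    ; x-apex = zero , refl
    ; x-mid = λ ()
    ; xx⁺ = λ { {zero} {zero} a≢b _ → contradiction refl a≢b }
    ; xx⁻ = λ ()
    ; xy⁺ = λ _ eq → inj₁ (refl , eq)
    ; xy⁻ = λ { i<n (inj₁ (_ , eq)) → refl , eq ; i<n (inj₂ (inj₁ (_ , refl))) → contradiction i<n (<-irrefl refl) }
    ; xz⁺ = λ _ eq → inj₂ (inj₁ (refl , eq))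
    ; xz⁻ = λ { n≤i (inj₁ (_ , refl)) → contradiction n≤i (<-irrefl refl) ; _ (inj₂ (inj₁ (_ , eq))) → refl , eq }
    }

  F4-realisation : Realisation n loHi (F4 n)
  F4-realisation = realisation n 2 _ _ _ {loHi} {1} record
    { yz-off = inj₂ (refl , refl)
    ; place-x = centre-apex
    ; x-inj = centre-apex-inj
    ; x-range = centre-apex-range
    ; x-apex = suc zero , refl
    ; x-mid = λ _ → zero , refl
    ; xx⁺ = λ _ ()
    ; xx⁻ = λ { {zero} {zero} l → contradiction l (Link-irrefl loHi n {just n})
              ; {zero} {suc zero} (inj₁ (_ , eq)) → contradiction eq 1+n≢n
              ; {zero} {suc zero} (inj₂ (inj₂ (_ , eq))) → contradiction (sym eq) 1+n≢n
              ; {suc zero} {zero} (inj₁ (_ , eq)) → contradiction eq 1+n≢n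
              ; {suc zero} {zero} (inj₂ (inj₂ (_ , eq))) → contradiction (sym eq) 1+n≢n
              ; {suc zero} {suc zero} () }
    ; xy⁺ = λ { {zero} _ eq → inj₂ eq ; {suc zero} _ eq → inj₁ (refl , eq) }
    ; xy⁻ = λ { {zero} i<n (inj₁ refl) → contradiction i<n (<-asym ≤-refl)
              ; {zero} _ (inj₂ eq) → refl , eq
              ; {suc zero} _ (inj₁ (_ , eq)) → refl , eq
              ; {suc zero} i<n (inj₂ (inj₂ (_ , refl))) → contradiction i<n (<-asym ≤-refl) }
    ; xz⁺ = λ { {zero} _ eq → inj₁ (sym eq) ; {suc zero} _ eq → inj₂ (inj₂ (refl , eq)) }
    ; xz⁻ = λ { {zero} _ (inj₁ eq) → refl , sym eq
              ; {zero} n<i (inj₂ refl) → contradiction n<i (<-asym ≤-refl)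
              ; {suc zero} n<i (inj₁ (_ , refl)) → contradiction n<i (<-asym ≤-refl)
              ; {suc zero} _ (inj₂ (inj₂ (_ , eq))) → refl , eq }
    }

  F5-realisation : Realisation n allThree (F5 n)
  F5-realisation = realisation n 2 _ _ _ {allThree} {1} record
    { yz-off = inj₂ (refl , refl)
    ; place-x = centre-apex
    ; x-inj = centre-apex-inj
    ; x-range = centre-apex-range
    ; x-apex = suc zero , refl
    ; x-mid = λ _ → zero , refl
    ; xx⁺ = λ { {zero} {zero} a≢b _ → contradiction refl a≢b
              ; {zero} {suc zero} _ _ → inj₂ (inj₁ (refl , refl))
              ; {suc zero} {zero} _ _ → inj₂ (inj₁ (refl , refl))
              ; {suc zero} {suc zero} a≢b _ → contradiction refl a≢b }
    ; xx⁻ = λ _ → inj₁ refl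
    ; xy⁺ = λ { {zero} _ eq → inj₂ eq ; {suc zero} _ eq → inj₁ (refl , eq) }
    ; xy⁻ = λ { {zero} i<n (inj₁ refl) → contradiction i<n (<-asym ≤-refl)
              ; {zero} _ (inj₂ eq) → refl , eq
              ; {suc zero} _ (inj₁ (_ , eq)) → refl , eq
              ; {suc zero} i<n (inj₂ (inj₁ (_ , refl))) → contradiction i<n (<-irrefl refl)
              ; {suc zero} i<n (inj₂ (inj₂ (_ , refl))) → contradiction i<n (<-asym ≤-refl) }
    ; xz⁺ = λ { {zero} _ eq → inj₁ (sym eq) ; {suc zero} _ eq → inj₂ (inj₂ (refl , eq)) }
    ; xz⁻ = λ { {zero} _ (inj₁ eq) → refl , sym eq
              ; {zero} n<i (inj₂ refl) → contradiction n<i (<-asym ≤-refl)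
              ; {suc zero} n<i (inj₁ (_ , refl)) → contradiction n<i (<-asym ≤-refl)
              ; {suc zero} n<i (inj₂ (inj₁ (_ , refl))) → contradiction n<i (<-irrefl refl)
              ; {suc zero} _ (inj₂ (inj₂ (_ , eq))) → refl , eq }
    }

-- Embeddings given by positions

⇔-embedding : ∀ {H G} (f : V H → V G) → (∀ i j → f i ≡ f j → i ≡ j) →
  (∀ i j → Adj G (f i) (f j) ⇔ Adj H i j) → H ⊑ G
⇔-embedding f inj iff = f , inj , λ i j → Bool.⇔→≡ (iff i j)

Near : ℕ → ℕ → Set
Near i j = suc i ≡ j ⊎ i ≡ j ⊎ i ≡ suc j

near : ∀ {i j} → i ≤ suc j → j ≤ suc i → Near i j
near {zero} {zero} _ _ = inj₂ (inj₁ refl)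
near {zero} {suc zero} _ _ = inj₁ refl
near {suc zero} {zero} _ _ = inj₂ (inj₂ refl)
near {suc i} {suc j} (s≤s p) (s≤s q) with near p q
... | inj₁ eq = inj₁ (cong suc eq)
... | inj₂ (inj₁ eq) = inj₂ (inj₁ (cong suc eq))
... | inj₂ (inj₂ eq) = inj₂ (inj₂ (cong suc eq))
near {zero} {suc (suc _)} _ (s≤s ())
near {suc (suc _)} {zero} (s≤s ()) _

Touch-shift : ∀ {π s c i} → Touch π c i → Touch π (s + c) (s + i)
Touch-shift {s = s} {c} {i} (inj₁ (b , refl)) = inj₁ (b , sym (+-suc s i))
Touch-shift (inj₂ (inj₁ (b , refl))) = inj₂ (inj₁ (b , refl))
Touch-shift {s = s} {c} (inj₂ (inj₂ (b , refl))) = inj₂ (inj₂ (b , +-suc s c))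

Touch-unshift : ∀ {π s c i} → Touch π (s + c) (s + i) → Touch π c i
Touch-unshift {s = s} {c} {i} (inj₁ (b , eq)) = inj₁ (b , +-cancelˡ-≡ s _ _ (trans (+-suc s i) eq))
Touch-unshift {s = s} (inj₂ (inj₁ (b , eq))) = inj₂ (inj₁ (b , +-cancelˡ-≡ s _ _ eq))
Touch-unshift {s = s} {c} (inj₂ (inj₂ (b , eq))) = inj₂ (inj₂ (b , +-cancelˡ-≡ s _ _ (trans eq (sym (+-suc s c)))))

module _ {n π F} (R : Realisation n π F) where
  open Realisation R

  -- The apex and all positions below `n + n` are occupied in F, so an assignment of positions with
  -- the right links pulls back to vertices.
  ⊑-realised : ∀ {H} (ψ : V H → Maybe ℕ) → (∀ {u v} → ψ u ≡ ψ v → u ≡ v) →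
    (∀ {u i} → ψ u ≡ just i → i < n + n) → (∀ {u v} → Adj H u v ⇔ Link π n (ψ u) (ψ v)) → H ⊑ F
  ⊑-realised {H} ψ ψ-inj ψ-bound ψ-adj = ⇔-embedding {H} {F} f
      (λ u v eq → ψ-inj (trans (sym (place-f u)) (trans (cong place eq) (place-f v))))
      λ u v → mk⇔
        (λ a → from ψ-adj (subst₂ (Link π n) (place-f u) (place-f v) (to place-adj a)))
        (λ a → from place-adj (subst₂ (Link π n) (sym (place-f u)) (sym (place-f v)) (to ψ-adj a)))
    where
    open Equivalence
    locate : ∀ u s → ψ u ≡ s → ∃ λ w → place w ≡ s
    locate u nothing eq = onto-apex
    locate u (just i) eq = onto-position (ψ-bound eq)
    f : V H → V F
    f u = proj₁ (locate u (ψ u) refl)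
    place-f : ∀ u → place (f u) ≡ ψ u
    place-f u = proj₂ (locate u (ψ u) refl)

-- Layered paths and the vertices parallel to them

module LayeredPaths (G : Graph) (connected : Connected G) (r : V G) where
  open Rooted G connected r public

  module _ {m} (P : Layered m) where
    open Layered P

    at-inj : ∀ {i j} → i ≤ m → j ≤ m → at i ≡ at j → i ≡ j
    at-inj i≤ j≤ eq = trans (sym (layer i≤)) (trans (cong depth eq) (layer j≤))

    adj-near : ∀ {v j} → j ≤ m → Adj G v (at j) → Near (depth v) j
    adj-near j≤ a = near (subst (λ d → _ ≤ suc d) (layer j≤) (depth-lipschitz a))
      (subst (_≤ suc _) (layer j≤) (depth-lipschitz (Adj-sym G a)))

    -- Adjacent vertices are at most one layer apart, which makes every layered path induced.
    at-adj : ∀ {i j} → i ≤ m → j ≤ m → Adj G (at i) (at j) ⇔ (suc i ≡ j ⊎ suc j ≡ i)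
    at-adj {i} {j} i≤ j≤ = mk⇔ to λ { (inj₁ refl) → link j≤ ; (inj₂ refl) → Adj-sym G (link i≤) }
      where
      to : Adj G (at i) (at j) → suc i ≡ j ⊎ suc j ≡ i
      to a with subst (λ d → Near d j) (layer i≤) (adj-near j≤ a)
      ... | inj₁ eq = inj₁ eq
      ... | inj₂ (inj₁ refl) = contradiction refl (Adj⇒≢ G a)
      ... | inj₂ (inj₂ eq) = inj₂ (sym eq)

    -- Translation by `c ∸ n` moves the centre of F to position `c`. The positions up to `n + n`
    -- then end at `c + n`, so a margin of n on both sides of `c` is what F needs.
    attach : ∀ {n π F v c} → Realisation n π F → n ≤ c → c + n ≤ m →
      (∀ {j} → j ≤ m → v ≢ at j) → (∀ {j} → j ≤ m → Adj G v (at j) → Touch π c j) →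
      (∀ {j} → Touch π c j → Adj G v (at j)) → F ⊑ G
    attach {n} {π} {F} {v} {c} R n≤c c+n≤m off touch⁺ touch⁻ =
      ⇔-embedding {F} {G} (λ u → φ (place u)) (λ u w eq → place-inj (φ-inj (place u) (place w) (place-bound {u}) (place-bound {w}) eq))
        λ u w → mk⇔
          (λ a → from place-adj (φ⁻ (place u) (place w) (place-bound {u}) (place-bound {w}) a))
          (λ a → φ⁺ (place u) (place w) (place-bound {u}) (place-bound {w}) (to place-adj a))
      where
      open Realisation R
      open Equivalence
      s : ℕ
      s = c ∸ n
      s+n : s + n ≡ c
      s+n = m∸n+n≡m n≤c
      φ : Maybe ℕ → V G
      φ nothing = v
      φ (just i) = at (s + i)
      Bounded : Maybe ℕ → Set
      Bounded t = ∀ {i} → t ≡ just i → i ≤ n + n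
      s+≤m : ∀ {i} → Bounded (just i) → s + i ≤ m
      s+≤m b = ≤-trans (+-monoʳ-≤ s (b refl))
        (≤-trans (≤-reflexive (trans (sym (+-assoc s n n)) (cong (_+ n) s+n))) c+n≤m)
      φ-inj : ∀ t t′ → Bounded t → Bounded t′ → φ t ≡ φ t′ → t ≡ t′
      φ-inj nothing nothing _ _ _ = refl
      φ-inj nothing (just i) _ b eq = contradiction eq (off (s+≤m b))
      φ-inj (just i) nothing b _ eq = contradiction (sym eq) (off (s+≤m b))
      φ-inj (just i) (just j) b b′ eq = cong just (+-cancelˡ-≡ s _ _ (at-inj (s+≤m b) (s+≤m b′) eq))
      touch-at : ∀ {i} → Bounded (just i) → Adj G v (at (s + i)) → Touch π n i
      touch-at {i} b a = Touch-unshift {s = s} (subst (λ k → Touch π k (s + i)) (sym s+n) (touch⁺ (s+≤m b) a))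
      φ⁻ : ∀ t t′ → Bounded t → Bounded t′ → Adj G (φ t) (φ t′) → Link π n t t′
      φ⁻ nothing nothing _ _ a = contradiction refl (Adj⇒≢ G a)
      φ⁻ nothing (just i) _ b a = touch-at b a
      φ⁻ (just i) nothing b _ a = touch-at b (Adj-sym G a)
      φ⁻ (just i) (just j) b b′ a with to (at-adj (s+≤m b) (s+≤m b′)) a
      ... | inj₁ eq = inj₁ (+-cancelˡ-≡ s _ _ (trans (+-suc s i) eq))
      ... | inj₂ eq = inj₂ (+-cancelˡ-≡ s _ _ (trans (+-suc s j) eq))
      at-touch : ∀ {i} → Touch π n i → Adj G v (at (s + i))
      at-touch {i} t = touch⁻ (subst (λ k → Touch π k (s + i)) s+n (Touch-shift {s = s} t))
      φ⁺ : ∀ t t′ → Bounded t → Bounded t′ → Link π n t t′ → Adj G (φ t) (φ t′)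
      φ⁺ nothing (just i) _ b l = at-touch l
      φ⁺ (just i) nothing b _ l = Adj-sym G (at-touch l)
      φ⁺ (just i) (just j) b b′ (inj₁ refl) = from (at-adj (s+≤m b) (s+≤m b′)) (inj₁ (sym (+-suc s i)))
      φ⁺ (just i) (just j) b b′ (inj₂ refl) = from (at-adj (s+≤m b) (s+≤m b′)) (inj₂ (sym (+-suc s j)))

    -- v lies in layer k + 1 and can replace the vertex of P there.
    Parallel : ℕ → V G → Set
    Parallel k v = depth v ≡ suc k × Adj G v (at k) × Adj G v (at (suc (suc k)))

    at-parallel : ∀ {k} → suc k < m → Parallel k (at (suc k))
    at-parallel k< = layer (<⇒≤ k<) , Adj-sym G (link (<-trans ≤-refl k<)) , link k<

    private
      off-path : ∀ {v k} → depth v ≡ suc k → v ≢ at (suc k) → ∀ {j} → j ≤ m → v ≢ at j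
      off-path {v} d v≢ j≤ refl with refl ← trans (sym d) (layer j≤) = v≢ refl

      neighbours : ∀ {v k} → depth v ≡ suc k → ∀ {j} → j ≤ m → Adj G v (at j) →
        j ≡ k ⊎ j ≡ suc k ⊎ j ≡ suc (suc k)
      neighbours d j≤ a with subst (λ d → Near d _) d (adj-near j≤ a)
      ... | inj₁ eq = inj₂ (inj₂ (sym eq))
      ... | inj₂ (inj₁ eq) = inj₂ (inj₁ (sym eq))
      ... | inj₂ (inj₂ eq) = inj₁ (sym (suc-injective eq))

    module _ {n} (noF1 : ¬ F1 n ⊑ G) (noF2 : ¬ F2 n ⊑ G) where

      -- If `v` is off the path, its neighbours on it are among `k`, `k + 1`, `k + 2`, and every
      -- nonempty selection without both outer ones is an `F1` or an `F2`. The position `i` and the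
      -- centre of that F both lie among these three, so they differ by at most 2: this is the 2
      -- added to the margin n.
      adjacent-parallel : ∀ {v i} → 2 + n ≤ i → 2 + (i + n) ≤ m → Adj G v (at i) → ∃ λ k → Parallel k v
      adjacent-parallel {v} {i} lo≤ ≤hi a = cases (depth v) refl
        where
        i≤m : i ≤ m
        i≤m = ≤-trans (≤-trans (m≤m+n i n) (m≤n+m (i + n) 2)) ≤hi
        cases : ∀ d → depth v ≡ d → ∃ λ k → Parallel k v
        cases zero eq with subst (λ d → Near d i) eq (adj-near i≤m a)
        ... | inj₁ refl = contradiction lo≤ λ { (s≤s ()) }
        ... | inj₂ (inj₁ refl) = contradiction lo≤ λ ()
        cases (suc k) eq with v ≟ at (suc k)
        ... | yes refl = k , at-parallel (≤-trans (s≤s (m≤m+n (suc k) n)) k-bound)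
          where
          k-bound : 2 + k + n ≤ m
          k-bound with subst (λ d → Near d i) eq (adj-near i≤m a)
          ... | inj₁ refl = ≤-trans (m≤n+m _ 2) ≤hi
          ... | inj₂ (inj₁ refl) = ≤-trans (m≤n+m _ 1) ≤hi
          ... | inj₂ (inj₂ refl) = ≤hi
        ... | no v≢ = k , eq , neighbour-pair
          where
          n≤k : n ≤ k
          n≤k with subst (λ d → Near d i) eq (adj-near i≤m a)
          ... | inj₁ refl = ≤-pred (≤-pred lo≤)
          ... | inj₂ (inj₁ refl) = ≤-trans (m≤n+m _ 1) (≤-pred lo≤)
          ... | inj₂ (inj₂ refl) = ≤-trans (m≤n+m _ 2) lo≤
          k-bound : 2 + k + n ≤ m
          k-bound with subst (λ d → Near d i) eq (adj-near i≤m a)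
          ... | inj₁ refl = ≤-trans (m≤n+m _ 2) ≤hi
          ... | inj₂ (inj₁ refl) = ≤-trans (m≤n+m _ 1) ≤hi
          ... | inj₂ (inj₂ refl) = ≤hi
          off : ∀ {j} → j ≤ m → v ≢ at j
          off = off-path eq v≢
          nbr : ∀ {j} → j ≤ m → Adj G v (at j) → j ≡ k ⊎ j ≡ suc k ⊎ j ≡ suc (suc k)
          nbr = neighbours eq
          neighbour-pair : Adj G v (at k) × Adj G v (at (suc (suc k)))
          -- A single neighbour is the centre of an `F1`; of two consecutive neighbours the later
          -- one is the centre of an `F2`. No neighbour at all contradicts `a`.
          neighbour-pair with Adj? G v (at k) | Adj? G v (at (suc k)) | Adj? G v (at (suc (suc k)))
          ... | yes a₀ | _ | yes a₂ = a₀ , a₂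
          ... | yes a₀ | yes a₁ | no ¬a₂ = contradiction
            (attach (F2-realisation n) (m≤n⇒m≤1+n n≤k) (≤-trans (n≤1+n _) k-bound) off
              (λ j≤ b → [ (λ { refl → inj₁ (refl , refl) }) , [ (λ { refl → inj₂ (inj₁ (refl , refl)) }) , (λ { refl → contradiction b ¬a₂ }) ]′ ]′ (nbr j≤ b))
              (λ { (inj₁ (_ , refl)) → a₀ ; (inj₂ (inj₁ (_ , refl))) → a₁ })) noF2
          ... | no ¬a₀ | yes a₁ | yes a₂ = contradiction
            (attach {c = suc (suc k)} (F2-realisation n) (m≤n⇒m≤1+n (m≤n⇒m≤1+n n≤k)) k-bound off
              (λ j≤ b → [ (λ { refl → contradiction b ¬a₀ }) , [ (λ { refl → inj₁ (refl , refl) }) , (λ { refl → inj₂ (inj₁ (refl , refl)) }) ]′ ]′ (nbr j≤ b))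
              (λ { (inj₁ (_ , refl)) → a₁ ; (inj₂ (inj₁ (_ , refl))) → a₂ })) noF2
          ... | yes a₀ | no ¬a₁ | no ¬a₂ = contradiction
            (attach (F1-realisation n) n≤k (≤-trans (m≤n+m _ 2) k-bound) off
              (λ j≤ b → [ (λ { refl → inj₂ (inj₁ (refl , refl)) }) , [ (λ { refl → contradiction b ¬a₁ }) , (λ { refl → contradiction b ¬a₂ }) ]′ ]′ (nbr j≤ b))
              (λ { (inj₂ (inj₁ (_ , refl))) → a₀ })) noF1
          ... | no ¬a₀ | yes a₁ | no ¬a₂ = contradiction
            (attach (F1-realisation n) (m≤n⇒m≤1+n n≤k) (≤-trans (m≤n+m _ 1) k-bound) off
              (λ j≤ b → [ (λ { refl → contradiction b ¬a₀ }) , [ (λ { refl → inj₂ (inj₁ (refl , refl)) }) , (λ { refl → contradiction b ¬a₂ }) ]′ ]′ (nbr j≤ b))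
              (λ { (inj₂ (inj₁ (_ , refl))) → a₁ })) noF1
          ... | no ¬a₀ | no ¬a₁ | yes a₂ = contradiction
            (attach (F1-realisation n) (m≤n⇒m≤1+n (m≤n⇒m≤1+n n≤k)) k-bound off
              (λ j≤ b → [ (λ { refl → contradiction b ¬a₀ }) , [ (λ { refl → contradiction b ¬a₁ }) , (λ { refl → inj₂ (inj₁ (refl , refl)) }) ]′ ]′ (nbr j≤ b))
              (λ { (inj₂ (inj₁ (_ , refl))) → a₂ })) noF1
          ... | no ¬a₀ | no ¬a₁ | no ¬a₂ =
            contradiction a ([ (λ { refl → ¬a₀ }) , [ (λ { refl → ¬a₁ }) , (λ { refl → ¬a₂ }) ]′ ]′ (nbr i≤m a))

    module _ {n} (noF4 : ¬ F4 n ⊑ G) (noF5 : ¬ F5 n ⊑ G) where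

      -- A second vertex parallel to the path completes `F5` or `F4` around position `k + 1`,
      -- according to whether it is adjacent to the vertex there.
      parallel-unique : ∀ {k v} → n ≤ k → suc (k + n) ≤ m → Parallel k v → v ≡ at (suc k)
      parallel-unique {k} {v} n≤k k-bound (d , a₀ , a₂) with v ≟ at (suc k)
      ... | yes eq = eq
      ... | no v≢ with Adj? G v (at (suc k))
      ...   | yes a₁ = contradiction
        (attach (F5-realisation n) (m≤n⇒m≤1+n n≤k) k-bound (off-path d v≢)
          (λ j≤ b → [ (λ { refl → inj₁ (refl , refl) }) , [ (λ { refl → inj₂ (inj₁ (refl , refl)) }) , (λ { refl → inj₂ (inj₂ (refl , refl)) }) ]′ ]′ (neighbours d j≤ b))
          (λ { (inj₁ (_ , refl)) → a₀ ; (inj₂ (inj₁ (_ , refl))) → a₁ ; (inj₂ (inj₂ (_ , refl))) → a₂ })) noF5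
      ...   | no ¬a₁ = contradiction
        (attach (F4-realisation n) (m≤n⇒m≤1+n n≤k) k-bound (off-path d v≢)
          (λ j≤ b → [ (λ { refl → inj₁ (refl , refl) }) , [ (λ { refl → contradiction b ¬a₁ }) , (λ { refl → inj₂ (inj₂ (refl , refl)) }) ]′ ]′ (neighbours d j≤ b))
          (λ { (inj₁ (_ , refl)) → a₀ ; (inj₂ (inj₂ (_ , refl))) → a₂ })) noF4

  module _ {m} (P : Layered m) {k v} (par : Parallel P k v) where
    open Layered P

    private
      at′ : ℕ → V G
      at′ j with j ℕ.≟ suc k
      ... | yes _ = v
      ... | no _ = at j

    at′-new : at′ (suc k) ≡ v
    at′-new with suc k ℕ.≟ suc k
    ... | yes _ = refl
    ... | no ≢ = contradiction refl ≢

    at′-old : ∀ {j} → j ≢ suc k → at′ j ≡ at j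
    at′-old {j} j≢ with j ℕ.≟ suc k
    ... | yes eq = contradiction eq j≢
    ... | no _ = refl

    replace : Layered m
    replace = record { at = at′ ; layer = layer′ ; link = link′ }
      where
      layer′ : ∀ {i} → i ≤ m → depth (at′ i) ≡ i
      layer′ {i} i≤ with i ℕ.≟ suc k
      ... | yes refl = proj₁ par
      ... | no _ = layer i≤
      link′ : ∀ {i} → i < m → Adj G (at′ i) (at′ (suc i))
      link′ {i} i< with i ℕ.≟ suc k | suc i ℕ.≟ suc k
      ... | yes refl | yes eq = contradiction eq 1+n≢n
      ... | yes refl | no _ = proj₂ (proj₂ par)
      ... | no _ | yes refl = Adj-sym G (proj₁ (proj₂ par))
      ... | no _ | no _ = link i<

  module _ {m} (P : Layered m) {n} (noF1 : ¬ F1 n ⊑ G) (noF2 : ¬ F2 n ⊑ G) where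

    -- On the path through `v`, the vertex `w` is parallel in some layer `l + 1` with `l` within one
    -- of `k`. If `l` equals `k`, both witnesses are old vertices. Otherwise one witness may be `v`,
    -- but the other is the old vertex at `k - 1` or `k + 3`, and `adjacent-parallel` is applied
    -- there on the original path. Its margins at these two positions give the constants 3 and 5.
    parallel-neighbour : ∀ {k v w} → 3 + n ≤ k → 5 + (k + n) ≤ m → Parallel P k v → Adj G w v →
      ∃ λ l → Parallel P l w
    parallel-neighbour {k} {v} {w} lo≤ ≤hi par a = from-replaced (adjacent-parallel P′ noF1 noF2
        (≤-trans (n≤1+n _) (≤-trans lo≤ (n≤1+n k))) (≤-trans (m≤n+m _ 2) ≤hi)
        (subst (Adj G w) (sym (at′-new P par)) a))
      where
      P′ : Layered m
      P′ = replace P par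
      a′ : Near (depth w) (suc k)
      a′ = adj-near P′ (≤-trans (≤-trans (m≤m+n (suc k) n) (m≤n+m _ 4)) ≤hi) (subst (Adj G w) (sym (at′-new P par)) a)
      from-replaced : (∃ λ l → Parallel P′ l w) → ∃ λ l → Parallel P l w
      from-replaced (l , d , a₀ , a₂) with subst (λ d → Near d (suc k)) d a′
      ... | inj₁ refl = adjacent-parallel P noF1 noF2 {i = l} (≤-pred lo≤) (≤-trans (m≤n+m _ 4) ≤hi)
              (subst (Adj G w) (at′-old P par {j = l} (<⇒≢ (s≤s (n≤1+n l)))) a₀)
      ... | inj₂ (inj₁ refl) = l , d , subst (Adj G w) (at′-old P par (<⇒≢ ≤-refl)) a₀
              , subst (Adj G w) (at′-old P par (>⇒≢ ≤-refl)) a₂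
      ... | inj₂ (inj₂ refl) = adjacent-parallel P noF1 noF2 {i = suc (suc l)}
              (≤-trans (n≤1+n _) (≤-trans lo≤ (m≤n+m k 3))) ≤hi
              (subst (Adj G w) (at′-old P par (>⇒≢ (s≤s (s≤s (n≤1+n k))))) a₂)

    -- Put `u` into the path. Its vertex at `k + 3` is unchanged and adjacent to `w`, so `w` is
    -- parallel to the new path too; its upper witness there is `u`.
    parallel-join : ∀ {k u w} → n ≤ k → 5 + (k + n) ≤ m → Parallel P k u → Parallel P (suc k) w → Adj G u w
    parallel-join {k} {u} {w} lo≤ ≤hi par (d , _ , a₂) with adjacent-parallel (replace P par) noF1 noF2 {i = suc (suc (suc k))}
        (m≤n⇒m≤1+n (s≤s (s≤s lo≤))) ≤hi (subst (Adj G w) (sym (at′-old P par (>⇒≢ (s≤s (s≤s (n≤1+n k)))))) a₂)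
    ... | l , d′ , a₀ , _ with refl ← trans (sym d) d′ = Adj-sym G (subst (Adj G w) (at′-new P par) a₀)

-- Ramsey's theorem and bounded degree

AllPairs-lookup : {A : Set} {R : A → A → Set} → (∀ {a b} → R a b → R b a) →
  ∀ {as} → AllPairs R as → ∀ {i j} → i ≢ j → R (lookup as i) (lookup as j)
AllPairs-lookup sy (_ ∷ _) {zero} {zero} i≢j = contradiction refl i≢j
AllPairs-lookup sy (r ∷ _) {zero} {suc j} _ = All.lookup r (∈-lookup j)
AllPairs-lookup sy (r ∷ _) {suc i} {zero} _ = sy (All.lookup r (∈-lookup i))
AllPairs-lookup sy (_ ∷ rs) {suc i} {suc j} i≢j = AllPairs-lookup sy rs (λ eq → i≢j (cong suc eq))

length-split : {A : Set} {P : A → Set} (P? : Decidable P) (as : List A) →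
  length as ≤ length (filter P? as) + length (filter (λ a → ¬? (P? a)) as)
length-split P? [] = z≤n
length-split P? (a ∷ as) with P? a
... | yes _ = s≤s (length-split P? as)
... | no _ = ≤-trans (s≤s (length-split P? as)) (≤-reflexive (sym (+-suc _ _)))

length-concatMap : {A B : Set} {f : A → List B} {c : ℕ} → (∀ a → length (f a) ≤ c) →
  ∀ as → length (concatMap f as) ≤ length as * c
length-concatMap bound [] = z≤n
length-concatMap {f = f} bound (a ∷ as) = ≤-trans (≤-reflexive (length-++ (f a)))
  (+-mono-≤ (bound a) (length-concatMap bound as))

-- An upper bound only: the added one counts the vertex whose neighbours and non-neighbours are
-- separated.
ramsey-number : ℕ → ℕ → ℕ
ramsey-number zero _ = 0
ramsey-number (suc _) zero = 0
ramsey-number (suc a) (suc b) = suc (ramsey-number a (suc b) + ramsey-number (suc a) b)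

module _ (G : Graph) where

  NonAdj : V G → V G → Set
  NonAdj u v = u ≢ v × ¬ Adj G u v

  NonAdj-sym : ∀ {u v} → NonAdj u v → NonAdj v u
  NonAdj-sym (u≢v , ¬a) = ≢-sym u≢v , λ a → ¬a (Adj-sym G a)

  HasSub : (V G → V G → Set) → List (V G) → ℕ → Set
  HasSub R vs k = ∃ λ us → length us ≡ k × AllPairs R us × us ⊆ vs

  HasSub-∷ : ∀ {R k vs v} {P : V G → Set} (P? : Decidable P) →
    (∀ {u} → u ∈ filter P? vs → R v u) → HasSub R (filter P? vs) k → HasSub R (v ∷ vs) (suc k)
  HasSub-∷ {v = v} P? rel (us , len , pairs , sub) =
    v ∷ us , cong suc len , All.tabulate (λ u∈ → rel (sub u∈)) ∷ pairs ,
    λ { (here eq) → here eq ; (there u∈) → there (proj₁ (∈-filter⁻ P? (sub u∈))) }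

  HasSub-⊆ : ∀ {R k us vs} → us ⊆ vs → HasSub R us k → HasSub R vs k
  HasSub-⊆ ⊆ (ws , len , pairs , sub) = ws , len , pairs , λ w∈ → ⊆ (sub w∈)

  ramsey : ∀ a b vs → Unique vs → ramsey-number a b ≤ length vs → HasSub (Adj G) vs a ⊎ HasSub NonAdj vs b
  ramsey zero b vs _ _ = inj₁ ([] , refl , [] , λ ())
  ramsey (suc a) zero vs _ _ = inj₂ ([] , refl , [] , λ ())
  ramsey (suc a) (suc b) (v ∷ vs) (v∉ ∷ unique) (s≤s large)
    with ramsey-number a (suc b) ≤? length (filter (Adj? G v) vs)
  ... | yes p with ramsey a (suc b) (filter (Adj? G v) vs) (Unique.filter⁺ (Adj? G v) unique) p
  ...   | inj₁ clique = inj₁ (HasSub-∷ (Adj? G v) (λ u∈ → proj₂ (∈-filter⁻ (Adj? G v) {xs = vs} u∈)) clique)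
  ...   | inj₂ indep = inj₂ (HasSub-⊆ (λ u∈ → there (proj₁ (∈-filter⁻ (Adj? G v) u∈))) indep)
  ramsey (suc a) (suc b) (v ∷ vs) (v∉ ∷ unique) (s≤s large) | no ¬p
    with ramsey (suc a) b (filter (λ u → ¬? (Adj? G v u)) vs) (Unique.filter⁺ (λ u → ¬? (Adj? G v u)) unique)
      -- Pigeonhole: with too few neighbours, the non-neighbours reach the second summand.
      (+-cancelˡ-≤ (ramsey-number a (suc b)) _ _ (≤-trans large (≤-trans (length-split (Adj? G v) vs) (+-monoˡ-≤ _ (≰⇒≥ ¬p)))))
  ...   | inj₁ clique = inj₁ (HasSub-⊆ (λ u∈ → there (proj₁ (∈-filter⁻ (λ u → ¬? (Adj? G v u)) u∈))) clique)
  ...   | inj₂ indep = inj₂ (HasSub-∷ (λ u → ¬? (Adj? G v u))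
            (λ u∈ → let m , ¬a = ∈-filter⁻ (λ u → ¬? (Adj? G v u)) {xs = vs} u∈ in All.lookup v∉ m , ¬a) indep)

  neighbourhood : V G → List (V G)
  neighbourhood v = filter (Adj? G v) (allFin (size G))

  ∈-neighbourhood : ∀ {u v} → Adj G v u → u ∈ neighbourhood v
  ∈-neighbourhood {u} {v} a = ∈-filter⁺ (Adj? G v) (∈-allFin u) a

  K-embedding : ∀ {us} → AllPairs (Adj G) us → K (length us) ⊑ G
  K-embedding {us} pairs = lookup us , inj , ad
    where
    inj : ∀ i j → lookup us i ≡ lookup us j → i ≡ j
    inj i j eq with i ≟ j
    ... | yes i≡j = i≡j
    ... | no i≢j = contradiction eq (Adj⇒≢ G (AllPairs-lookup (Adj-sym G) pairs i≢j))
    ad : ∀ i j → adj G (lookup us i) (lookup us j) ≡ adj (K (length us)) i j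
    ad i j with i ≟ j
    ... | yes refl = adj-irrefl G _
    ... | no i≢j = AllPairs-lookup (Adj-sym G) pairs i≢j

  K1-embedding : ∀ {v us} → AllPairs NonAdj us → us ⊆ neighbourhood v → K1 (length us) ⊑ G
  K1-embedding {v} {us} pairs sub = ⇔-embedding {K1 (length us)} {G} f inj λ i j → mk⇔ (to i j) (from i j)
    where
    f : Fin (suc (length us)) → V G
    f zero = v
    f (suc i) = lookup us i
    spoke : ∀ i → Adj G v (lookup us i)
    spoke i = proj₂ (∈-filter⁻ (Adj? G v) {xs = allFin (size G)} (sub (∈-lookup i)))
    inj : ∀ i j → f i ≡ f j → i ≡ j
    inj zero zero _ = refl
    inj zero (suc j) eq = contradiction eq (Adj⇒≢ G (spoke j))
    inj (suc i) zero eq = contradiction (sym eq) (Adj⇒≢ G (spoke i))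
    inj (suc i) (suc j) eq with i ≟ j
    ... | yes i≡j = cong suc i≡j
    ... | no i≢j = contradiction eq (proj₁ (AllPairs-lookup NonAdj-sym pairs i≢j))
    to : ∀ i j → Adj G (f i) (f j) → Adj (K1 (length us)) i j
    to zero zero a = contradiction refl (Adj⇒≢ G a)
    to zero (suc j) _ = refl
    to (suc i) zero _ = refl
    to (suc i) (suc j) a with i ≟ j
    ... | yes refl = contradiction refl (Adj⇒≢ G a)
    ... | no i≢j = contradiction a (proj₂ (AllPairs-lookup NonAdj-sym pairs i≢j))
    leaves : ∀ (i j : Fin (length us)) → adj (K1 (length us)) (suc i) (suc j) ≡ false
    leaves i j with i ≟ j
    ... | yes _ = refl
    ... | no _ = refl
    from : ∀ i j → Adj (K1 (length us)) i j → Adj G (f i) (f j)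
    from zero (suc j) _ = spoke j
    from (suc i) zero _ = Adj-sym G (spoke i)
    from (suc i) (suc j) a = contradiction (trans (sym a) (leaves i j)) λ ()

  module _ {n} (noK : ¬ K n ⊑ G) (noK1 : ¬ K1 n ⊑ G) where

    private
      Δ : ℕ
      Δ = ramsey-number n n

    -- A large neighbourhood contains n vertices forming a clique or an independent set, and the
    -- latter together with `v` is a star.
    degree< : ∀ v → length (neighbourhood v) < Δ
    degree< v = ≰⇒> λ large → [ (λ { (_ , refl , pairs , _) → noK (K-embedding pairs) })
                              , (λ { (_ , refl , pairs , sub) → noK1 (K1-embedding pairs sub) }) ]′
      (ramsey n n (neighbourhood v) (Unique.filter⁺ (Adj? G v) (Unique.allFin⁺ (size G))) large)

  -- All ends of walks of the given length, with repetitions: only upper bounds on the length of the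
  -- list matter, and any walk proves membership.
  around : ℕ → V G → List (V G)
  around zero v = v ∷ []
  around (suc j) v = concatMap (around j) (neighbourhood v)

  within : ℕ → V G → List (V G)
  within zero v = v ∷ []
  within (suc j) v = within j v ++ around (suc j) v

  ∈-around : ∀ {u v j} → Walk G u v j → v ∈ around j u
  ∈-around nil = here refl
  ∈-around (cons {w = w} {k = j} a p) = ∈-concatMap⁺ (around j) (Any.map (λ { refl → ∈-around p }) (∈-neighbourhood a))

  around⊆within : ∀ {i j v} → i ≤ j → around i v ⊆ within j v
  around⊆within {zero} {zero} _ w∈ = w∈
  around⊆within {i} {suc j} {v} i≤ w∈ with m≤n⇒m<n∨m≡n i≤
  ... | inj₁ (s≤s i≤j) = ∈-++⁺ˡ (around⊆within i≤j w∈)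
  ... | inj₂ refl = ∈-++⁺ʳ (within j v) w∈

ball-size : ℕ → ℕ → ℕ
ball-size Δ zero = 1
ball-size Δ (suc j) = ball-size Δ j + Δ ^ suc j

module _ {G : Graph} {Δ} (degree≤ : ∀ v → length (neighbourhood G v) ≤ Δ) where

  length-around : ∀ j v → length (around G j v) ≤ Δ ^ j
  length-around zero v = ≤-refl
  length-around (suc j) v = ≤-trans (length-concatMap (length-around j) (neighbourhood G v)) (*-monoˡ-≤ (Δ ^ j) (degree≤ v))

  length-within : ∀ j v → length (within G j v) ≤ ball-size Δ j
  length-within zero v = ≤-refl
  length-within (suc j) v = ≤-trans (≤-reflexive (length-++ (within G j v))) (+-mono-≤ (length-within j v) (length-around (suc j) v))

-- Covers and partitions as lists of paths

module _ {G : Graph} where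

  Visits : V G → IsoPath G → Set
  Visits v p = ∃ λ j → vert p j ≡ v

  DisjointPaths : IsoPath G → IsoPath G → Set
  DisjointPaths p q = ∀ i j → vert p i ≢ vert q j

  ispc-from-list : ∀ {c} (ps : List (IsoPath G)) → length ps ≤ c → (∀ v → Any (Visits v) ps) → IspcAtMost G c
  ispc-from-list ps len covers =
    length ps , len , lookup ps , λ v → Any.index (covers v) , Any.lookup-index (covers v)

  ispp-from-list : ∀ {c} (ps : List (IsoPath G)) → length ps ≤ c → (∀ v → Any (Visits v) ps) →
    AllPairs DisjointPaths ps → IsppAtMost G c
  ispp-from-list ps len covers disjoint = length ps , len , lookup ps ,
      (λ v → Any.index (covers v) , Any.lookup-index (covers v)) , separate
    where
    separate : IsDisjoint G (length ps) (lookup ps)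
    separate i i′ j j′ eq with i ≟ i′
    ... | yes i≡i′ = i≡i′
    ... | no i≢i′ = contradiction eq
      (AllPairs-lookup {R = DisjointPaths} (λ d i j eq → d j i (sym eq)) disjoint i≢i′ j j′)

nth : {A : Set} → A → List A → ℕ → A
nth d [] _ = d
nth d (a ∷ as) zero = a
nth d (a ∷ as) (suc t) = nth d as t

∈⇒nth : {A : Set} {d a : A} {as : List A} → a ∈ as → ∃ λ t → t < length as × nth d as t ≡ a
∈⇒nth (here refl) = 0 , s≤s z≤n , refl
∈⇒nth (there a∈) = let t , t< , eq = ∈⇒nth a∈ in suc t , s≤s t< , eq

walk-lipschitz-end : ∀ {G} g → Lipschitz {G} g → ∀ {u v k} → Walk G u v k → g v ≤ k + g u
walk-lipschitz-end g lip nil = ≤-refl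
walk-lipschitz-end {G} g lip (cons {k = k} a w) = ≤-trans (walk-lipschitz-end g lip w)
  (≤-trans (+-monoʳ-≤ k (lip (Adj-sym G a))) (≤-reflexive (+-suc k _)))

-- Isometric paths from layers

module IsometricPaths (G : Graph) (connected : Connected G) (r : V G) where
  open LayeredPaths G connected r public

  -- A step of a walk changes the depth by at most one, so no walk from layer `s` to layer `s + len`
  -- is shorter than `len`.
  layered-path : ∀ (q : ℕ → V G) s len → (∀ {i} → i ≤ len → depth (q i) ≡ s + i) →
    (∀ {i} → i < len → Adj G (q i) (q (suc i))) → IsoPath G
  layered-path q s len q-depth q-adj = record
    { len = len
    ; vert = λ i → q (toℕ i)
    ; step = λ i → subst (λ k → Adj G (q k) (q (suc (toℕ i)))) (sym (toℕ-inject₁ i)) (q-adj (toℕ<n i))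
    ; distinct = λ i j eq → toℕ-injective (+-cancelˡ-≡ s _ _
        (trans (sym (q-depth (≤-pred (toℕ<n i)))) (trans (cong depth eq) (q-depth (≤-pred (toℕ<n j))))))
    ; shortest = λ k w → +-cancelˡ-≤ s _ _ (subst₂ _≤_
        (trans (cong (λ i → depth (q i)) (toℕ-fromℕ len)) (q-depth ≤-refl))
        (trans (cong (k +_) (trans (q-depth z≤n) (+-identityʳ s))) (+-comm k s))
        (walk-lipschitz-end depth depth-lipschitz w))
    }

  single : V G → IsoPath G
  single v = layered-path (λ _ → v) (depth v) 0 (λ { z≤n → sym (+-identityʳ (depth v)) }) (λ ())

  descend : ∀ v {j} → j ≤ depth v → Walk G (ancestor j v) v j
  descend v {zero} _ = nil
  descend v {suc j} j< = cons (Adj-sym G (parent-adj (ancestor j v) (subst (0 <_) (sym (depth-ancestor j v)) (m<n⇒0<n∸m j<))))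
    (descend v (<⇒≤ j<))

  depth-zero : ∀ {v} → depth v ≡ 0 → v ≡ r
  depth-zero {v} eq with nil ← subst (Walk G v r) eq (depth-walk v) = refl

  walk-from-root : ∀ v → Walk G r v (depth v)
  walk-from-root v = subst (λ u → Walk G u v (depth v))
    (depth-zero (trans (depth-ancestor (depth v) v) (n∸n≡0 (depth v)))) (descend v ≤-refl)

  -- One long path for each vertex of a fixed layer

  module Spines (n : ℕ) (noF1 : ¬ F1 n ⊑ G) (noF2 : ¬ F2 n ⊑ G) where

    -- The first layer from which `parallel-neighbour` applies: for a vertex of layer `suc k` it
    -- requires `3 + n ≤ k`.
    base : ℕ
    base = 4 + n

    trunk : V G → V G
    trunk v = ancestor (depth v ∸ base) v

    trunk-depth : ∀ {v} → base ≤ depth v → depth (trunk v) ≡ base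
    trunk-depth {v} b≤ = trans (depth-ancestor (depth v ∸ base) v) (m∸[m∸n]≡n b≤)

    abstract
      -- A deepest vertex of the branch at `w`, so that no vertex of the branch goes beyond the
      -- spine. The default `w` is its own trunk in layer `base`, which `trunk-top` needs.
      top : V G → V G
      top w = argmax depth w (filter (λ v → trunk v ≟ w) (allFin (size G)))

      trunk-top : ∀ {w} → depth w ≡ base → trunk (top w) ≡ w
      trunk-top {w} d = argmax-all depth {P = λ v → trunk v ≡ w}
        (cong (λ j → ancestor j w) (trans (cong (_∸ base) d) (n∸n≡0 base)))
        (All.all-filter (λ v → trunk v ≟ w) (allFin (size G)))

      depth≤top : ∀ v → depth v ≤ depth (top (trunk v))
      depth≤top v = All.lookup (f[xs]≤f[argmax] {f = depth} (trunk v) _) (∈-filter⁺ (λ u → trunk u ≟ trunk v) (∈-allFin v) refl)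

    height : V G → ℕ
    height w = depth (top w)

    spine : ∀ w → Layered (height w)
    spine w = chain (top w)

    -- The layers base, …, end w form the middle part of spine w.
    end : V G → ℕ
    end w = height w ∸ (3 + n)

    Long : V G → Set
    Long w = depth w ≡ base × base < end w

    abstract
      Long? : ∀ w → Dec (Long w)
      Long? w = (depth w ℕ.≟ base) ×-dec (base <? end w)

    end-bound : ∀ {w i} → Long w → i ≤ end w → i + (3 + n) ≤ height w
    end-bound {w} {i} (_ , b<) i≤ =
      m≤o∸n⇒m+n≤o i {3 + n} (<⇒≤ (m∸n≢0⇒n<m (>⇒≢ (≤-<-trans z≤n b<)))) i≤

    -- Explains the `3 + n` in `end`: with `suc k` for `k` this is the bound `5 + (k + n)` that
    -- `parallel-neighbour` and `parallel-join` require.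
    middle-bound : ∀ {w k} → Long w → suc k ≤ end w → 4 + (k + n) ≤ height w
    middle-bound {w} {k} long k< = ≤-trans (≤-reflexive (rearrange k n)) (end-bound long k<)
      where
      rearrange : ∀ k n → 4 + (k + n) ≡ suc k + (3 + n)
      rearrange k n = cong suc (trans (cong (3 +_) (+-comm k n)) (+-comm (3 + n) k))

    -- The chain of `v` and the spine meet in layer `base`, at `w`. From there each vertex of the
    -- chain is a neighbour of a parallel one, hence parallel, and its depth determines the layer.
    spine-hit : ∀ {v w} → trunk v ≡ w → Long w → ∀ i → let k = i + (3 + n) in
      suc k ≤ depth v → suc k ≤ end w → Parallel (spine w) k (Layered.at (chain v) (suc k))
    spine-hit {v} {w} eq long@(d , b<) zero _ k≤ = subst (Parallel (spine w) (3 + n)) (trans (trunk-top d) (sym eq))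
      (at-parallel (spine w) (<-≤-trans b< (m∸n≤m (height w) (3 + n))))
    spine-hit {v} {w} eq long (suc i) k≤d k≤e
      with parallel-neighbour (spine w) {n} noF1 noF2 {k = i + (3 + n)} (m≤n+m _ i) (middle-bound {k = suc (i + (3 + n))} long k≤e)
             (spine-hit eq long i (<⇒≤ k≤d) (<⇒≤ k≤e)) (Adj-sym G (Layered.link (chain v) k≤d))
    ... | l , par with refl ← trans (sym (proj₁ par)) (Layered.layer (chain v) k≤d) = par

    -- For the vertices deeper than `end w`: their chain crosses layer `end w` at a parallel vertex,
    -- which is adjacent to the centre of this ball, and then descends at most `3 + n` layers. The
    -- radius is one more.
    leftover-of : V G → List (V G)
    leftover-of w = within G (4 + n) (Layered.at (spine w) (suc (end w)))

    leftover : List (V G)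
    leftover = within G (base + (4 + n)) r ++ concatMap leftover-of (around G base r)

    OnMiddle : V G → Set
    OnMiddle v = Long (trunk v) × ∃ λ i → let k = i + (3 + n) in suc k ≤ end (trunk v) × Parallel (spine (trunk v)) k v

    trunk∈around : ∀ {w} → depth w ≡ base → w ∈ around G base r
    trunk∈around {w} d = ∈-around G (subst (Walk G r w) d (walk-from-root w))

    leftover-or-middle : ∀ v → v ∈ leftover ⊎ OnMiddle v
    -- Up to this depth the ball around the root suffices; any deeper vertex forces its trunk to
    -- satisfy `Long`.
    leftover-or-middle v with depth v ≤? base + (4 + n)
    ... | yes d≤ = inj₁ (∈-++⁺ˡ (around⊆within G d≤ (∈-around G (walk-from-root v))))
    ... | no d≰ = by-end (depth v ≤? end w)
      where
      w : V G
      w = trunk v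
      d> : base + (4 + n) < depth v
      d> = ≰⇒> d≰
      b≤d : base ≤ depth v
      b≤d = ≤-trans (m≤m+n base (4 + n)) (<⇒≤ d>)
      d≤h : depth v ≤ height w
      d≤h = depth≤top v
      b<e : base < end w
      b<e = ≤-trans (m+n≤o⇒m≤o∸n (suc base) (≤-trans (+-monoʳ-≤ (suc base) (n≤1+n (3 + n))) d>))
        (∸-monoˡ-≤ (3 + n) d≤h)
      long : Long w
      long = trunk-depth b≤d , b<e
      layer-of : ∀ {d} → base ≤ d → suc ((d ∸ base) + (3 + n)) ≡ d
      layer-of {d} b≤ = trans (sym (+-suc (d ∸ base) (3 + n))) (m∸n+n≡m b≤)
      by-end : Dec (depth v ≤ end w) → v ∈ leftover ⊎ OnMiddle v
      by-end (yes d≤e) = inj₂ (long , depth v ∸ base , subst (_≤ end w) (sym eq) d≤e ,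
          subst (λ u → Parallel (spine w) (i + (3 + n)) u)
            (cong (λ j → ancestor j v) (trans (cong (depth v ∸_) eq) (n∸n≡0 (depth v))))
            (spine-hit refl long i (≤-reflexive eq) (subst (_≤ end w) (sym eq) d≤e)))
        where
        i = depth v ∸ base
        eq : suc (i + (3 + n)) ≡ depth v
        eq = layer-of b≤d
      by-end (no d≰e) = inj₁ (∈-++⁺ʳ (within G (base + (4 + n)) r)
          (∈-concatMap⁺ leftover-of (lose (trunk∈around (proj₁ long)) (around⊆within G (s≤s short) (∈-around G walk)))))
        where
        i = end w ∸ base
        eq : suc (i + (3 + n)) ≡ end w
        eq = layer-of (<⇒≤ b<e)
        e<d : end w < depth v
        e<d = ≰⇒> d≰e
        par : Parallel (spine w) (i + (3 + n)) (Layered.at (chain v) (suc (i + (3 + n))))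
        par = spine-hit refl long i (subst (_≤ depth v) (sym eq) (<⇒≤ e<d)) (≤-reflexive eq)
        walk : Walk G (Layered.at (spine w) (suc (end w))) v (suc (depth v ∸ end w))
        walk = subst (λ e → Walk G (Layered.at (spine w) (suc e)) v (suc (depth v ∸ e))) eq
          (cons (Adj-sym G (proj₂ (proj₂ par))) (descend v (m∸n≤m (depth v) (suc (i + (3 + n))))))
        short : depth v ∸ end w ≤ 3 + n
        short = ≤-trans (∸-monoˡ-≤ (end w) d≤h) (≤-reflexive (m∸[m∸n]≡n
          (≤-trans (m≤n+m (3 + n) 0) (end-bound {i = 0} long z≤n))))

-- Singletons for the ball around the root and for one ball per trunk, then at most Δ longer paths
-- per trunk; walks of length `4 + n` from the root reach at most `Δ ^ (4 + n)` trunks.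
path-bound : ℕ → ℕ → ℕ
path-bound Δ n = (ball-size Δ (4 + n + (4 + n)) + Δ ^ (4 + n) * ball-size Δ (4 + n)) + Δ ^ (4 + n) * Δ

-- Bounded covers and partitions

module BoundedCovers (G : Graph) (connected : Connected G) (r : V G) {n} (1≤n : 1 ≤ n)
  (noK : ¬ K n ⊑ G) (noK1 : ¬ K1 n ⊑ G) (noF1 : ¬ F1 n ⊑ G) (noF2 : ¬ F2 n ⊑ G) where

  open IsometricPaths G connected r
  open Spines n noF1 noF2

  private
    Δ : ℕ
    Δ = ramsey-number n n

    degree≤ : ∀ v → length (neighbourhood G v) ≤ Δ
    degree≤ v = <⇒≤ (degree< G {n} noK noK1 v)

    B : ℕ
    B = 4 + n

    e : V G → ℕ
    e = end

    S : ∀ w → Layered (height w)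
    S = spine

    open module S w = Layered (S w) using (at; layer; link)

    rest : List (V G)
    rest = leftover

    length-rest : length rest ≤ ball-size Δ (B + B) + Δ ^ B * ball-size Δ B
    length-rest = ≤-trans (≤-reflexive (length-++ (within G (B + B) r))) (+-mono-≤ (length-within degree≤ (B + B) r)
      (≤-trans (length-concatMap (λ w → length-within degree≤ B _) (around G B r))
               (*-monoˡ-≤ (ball-size Δ B) (length-around degree≤ B r))))

    mid-≤ : ∀ {w i} → Long w → i ≤ e w ∸ B → suc (i + (3 + n)) ≤ e w
    mid-≤ {w} {i} (_ , b<) i≤ = ≤-trans (≤-reflexive (sym (+-suc i (3 + n)))) (m≤o∸n⇒m+n≤o i (<⇒≤ b<) i≤)

    mid-index : ∀ {w i} → suc (i + (3 + n)) ≤ e w → i ≤ e w ∸ B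
    mid-index {w} {i} k≤ = m+n≤o⇒m≤o∸n i (≤-trans (≤-reflexive (+-suc i (3 + n))) k≤)

    mid-< : ∀ {w k} → Long w → suc k ≤ e w → suc k < height w
    mid-< {w} {k} long k≤ = ≤-trans (≤-trans (m≤m+n (2 + k) n) (m≤n+m _ 2)) (middle-bound {w} {k} long k≤)

    layer-shift : ∀ i → suc (i + (3 + n)) ≡ B + i
    layer-shift i = cong suc (+-comm i (3 + n))

    abstract
      Parallel? : ∀ w k v → Dec (Parallel (S w) k v)
      Parallel? w k v = (depth v ℕ.≟ suc k) ×-dec (Adj? G v (at w k) ×-dec Adj? G v (at w (suc (suc k))))

    adjust : ∀ {w k v} → Dec (Parallel (S w) k v) → V G
    adjust {v = v} (yes _) = v
    adjust {w} {k} (no _) = at w (suc k)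

    candidate : ℕ → V G → ℕ → V G
    candidate t w k = nth (at w (suc k)) (neighbourhood G (at w (suc (suc k)))) t

    -- Every vertex parallel in layer `suc k` is a neighbour of the spine vertex one layer deeper,
    -- so the indices below Δ reach all of them. A candidate that is not parallel gives way to the
    -- spine's own vertex, which keeps each choice usable.
    choose : ℕ → V G → ℕ → V G
    choose t w k = adjust (Parallel? w k (candidate t w k))

    choose-parallel : ∀ t w {k} → suc k < height w → Parallel (S w) k (choose t w k)
    choose-parallel t w {k} k< = adjusted (Parallel? w k (candidate t w k))
      where
      adjusted : ∀ {v} (d : Dec (Parallel (S w) k v)) → Parallel (S w) k (adjust d)
      adjusted (yes p) = p
      adjusted (no _) = at-parallel (S w) k<

    choose-onto : ∀ {w k v} → Parallel (S w) k v → ∃ λ t → t < Δ × choose t w k ≡ v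
    choose-onto {w} {k} {v} par with ∈⇒nth {d = at w (suc k)} (∈-neighbourhood G (Adj-sym G (proj₂ (proj₂ par))))
    ... | t , t< , eq = t , <-≤-trans t< (degree≤ _) , adjusted eq (Parallel? w k (candidate t w k))
      where
      adjusted : ∀ {u} → u ≡ v → (d : Dec (Parallel (S w) k u)) → adjust d ≡ v
      adjusted u≡v (yes _) = u≡v
      adjusted refl (no ¬p) = contradiction par ¬p

    -- Since consecutive parallel layers are completely joined, the choices may be made in each
    -- layer without regard to the others and still form a path.
    thread : ∀ w → Long w → ℕ → IsoPath G
    thread w long t = layered-path (λ i → choose t w (i + (3 + n))) B (e w ∸ B)
      (λ {i} i≤ → trans (proj₁ (choose-parallel t w (mid-< long (mid-≤ long i≤)))) (layer-shift i))
      (λ {i} i< → parallel-join (S w) {n} noF1 noF2 {k = i + (3 + n)} (≤-trans (m≤n+m n 3) (m≤n+m (3 + n) i))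
        (middle-bound {w} {suc i + (3 + n)} long (mid-≤ long i<))
        (choose-parallel t w (mid-< long (mid-≤ long (<⇒≤ i<))))
        (choose-parallel t w (mid-< long (mid-≤ long i<))))

    threads : ∀ {w} → Dec (Long w) → List (IsoPath G)
    threads {w} (yes long) = map (thread w long) (upTo Δ)
    threads (no _) = []

    length-threads : ∀ {w} (d : Dec (Long w)) → length (threads d) ≤ Δ
    length-threads {w} (yes long) = ≤-reflexive (trans (length-map (thread w long) (upTo Δ)) (length-upTo Δ))
    length-threads (no _) = z≤n

    threads-visit : ∀ {w v i} → Long w → suc (i + (3 + n)) ≤ e w → Parallel (S w) (i + (3 + n)) v →
      (d : Dec (Long w)) → Any (Visits v) (threads d)
    threads-visit long k≤ par (no ¬long) = contradiction long ¬long
    threads-visit {w} long k≤ par (yes long′) = let t , t< , eq = choose-onto par in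
      lose (∈-map⁺ (thread w long′) (∈-upTo⁺ t<))
        (fromℕ< (s≤s (mid-index k≤)) , trans (cong (λ j → choose t w (j + (3 + n))) (toℕ-fromℕ< (s≤s (mid-index k≤)))) eq)

    all-threads : V G → List (IsoPath G)
    all-threads w = threads (Long? w)

  ispc-bounded : IspcAtMost G (path-bound Δ n)
  ispc-bounded = ispc-from-list (map single rest ++ concatMap all-threads (around G B r))
      (≤-trans (≤-reflexive (length-++ (map single rest)))
        (+-mono-≤ (≤-trans (≤-reflexive (length-map single rest)) length-rest)
          (≤-trans (length-concatMap (λ w → length-threads (Long? w)) (around G B r)) (*-monoˡ-≤ Δ (length-around degree≤ B r)))))
      λ v → [ (λ v∈ → Any.++⁺ˡ (lose (∈-map⁺ single v∈) (zero , refl)))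
            , (λ { (long , i , k≤ , par) → Any.++⁺ʳ (map single rest)
                 (Any.concatMap⁺ all-threads (lose (trunk∈around (proj₁ long)) (threads-visit {i = i} long k≤ par (Long? _)))) }) ]′
        (leftover-or-middle v)

  module _ (noF4 : ¬ F4 n ⊑ G) (noF5 : ¬ F5 n ⊑ G) where

    private
      segment : ∀ w → Long w → IsoPath G
      segment w long = layered-path (λ i → at w (i + B)) B (e w ∸ B)
        (λ {i} i≤ → trans (layer w (inside i≤)) (+-comm i B))
        (λ i< → link w (inside i<))
        where
        inside : ∀ {i} → i ≤ e w ∸ B → i + B ≤ height w
        inside {i} i≤ = ≤-trans (m≤o∸n⇒m+n≤o i (<⇒≤ (proj₂ long)) i≤) (m∸n≤m _ (3 + n))

      -- All spine vertices are ancestors of `top w`, so from layer `base` on they share its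
      -- ancestor in that layer. Segments of different trunks are therefore disjoint.
      segment-trunk : ∀ {w} (long : Long w) j → trunk (vert (segment w long) j) ≡ w
      segment-trunk {w} long j = trans (cong (λ l → ancestor l (at w i)) (cong (_∸ B) (layer w i≤)))
          (trans (sym (ancestor-+ (i ∸ B) (height w ∸ i) (top w)))
            (trans (cong (λ l → ancestor l (top w)) steps) (trunk-top (proj₁ long))))
        where
        i : ℕ
        i = toℕ j + B
        i≤ : i ≤ height w
        i≤ = ≤-trans (m≤o∸n⇒m+n≤o (toℕ j) (<⇒≤ (proj₂ long)) (≤-pred (toℕ<n j))) (m∸n≤m _ (3 + n))
        steps : (i ∸ B) + (height w ∸ i) ≡ height w ∸ B
        steps = trans (sym (+-∸-comm (height w ∸ i) (m≤n+m B (toℕ j)))) (cong (_∸ B) (m+[n∸m]≡n i≤))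

      segments : ∀ {w} → Dec (Long w) → List (IsoPath G)
      segments {w} (yes long) = segment w long ∷ []
      segments (no _) = []

      length-segments : ∀ {w} (d : Dec (Long w)) → length (segments d) ≤ 1
      length-segments (yes _) = ≤-refl
      length-segments (no _) = z≤n

      segments-visit : ∀ {w v i} → Long w → suc (i + (3 + n)) ≤ e w → Parallel (S w) (i + (3 + n)) v →
        (d : Dec (Long w)) → Any (Visits v) (segments d)
      segments-visit long k≤ par (no ¬long) = contradiction long ¬long
      segments-visit {w} {v} {i} long k≤ par (yes _) = here (fromℕ< (s≤s (mid-index k≤)) ,
          trans (cong (λ j → at w (j + B)) (toℕ-fromℕ< (s≤s (mid-index k≤))))
            (trans (cong (at w) (+-suc i (3 + n)))
              (sym (parallel-unique (S w) {n} noF4 noF5 (≤-trans (m≤n+m n 3) (m≤n+m (3 + n) i))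
                (≤-trans (m≤n+m _ 3) (middle-bound {w} {i + (3 + n)} long k≤)) par))))

      segments-self : ∀ {w} (d : Dec (Long w)) → AllPairs DisjointPaths (segments d)
      segments-self (yes _) = [] ∷ []
      segments-self (no _) = []

      segments-disjoint : ∀ {w w′} → w ≢ w′ → (d : Dec (Long w)) (d′ : Dec (Long w′)) →
        All (λ p → All (DisjointPaths p) (segments d′)) (segments d)
      segments-disjoint w≢ (no _) _ = []
      segments-disjoint w≢ (yes _) (no _) = [] ∷ []
      segments-disjoint w≢ (yes long) (yes long′) = ((λ i j eq → w≢ (trans (sym (segment-trunk long i))
        (trans (cong (trunk) eq) (segment-trunk long′ j)))) ∷ []) ∷ []

      segments-of : V G → List (IsoPath G)
      segments-of w = segments (Long? w)

      -- Repetitions are removed here because a segment listed twice would not be disjoint from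
      -- itself.
      trunks : List (V G)
      trunks = deduplicate _≟_ (around G B r)

      all-segments : List (IsoPath G)
      all-segments = concatMap segments-of trunks

      Visited? : ∀ v → Dec (Any (Visits v) all-segments)
      Visited? v = Any.any? (λ p → any? λ j → vert p j ≟ v) all-segments

      -- The leftover balls may overlap the segments, and a vertex already on a segment cannot also
      -- be a singleton of the partition.
      unvisited : List (V G)
      unvisited = filter (λ v → ¬? (Visited? v)) (deduplicate _≟_ rest)

      length-unvisited : length unvisited ≤ length rest
      length-unvisited = ≤-trans (length-filter (λ v → ¬? (Visited? v)) (deduplicate _≟_ rest)) (length-deduplicate _≟_ rest)

      length-all-segments : length all-segments ≤ Δ ^ B * 1
      length-all-segments = ≤-trans (length-concatMap (λ w → length-segments (Long? w)) trunks)
        (*-monoˡ-≤ 1 (≤-trans (length-deduplicate _≟_ (around G B r)) (length-around degree≤ B r)))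

      visit : ∀ v → Any (Visits v) (map single unvisited ++ all-segments)
      visit v with Visited? v | leftover-or-middle v
      ... | yes a | _ = Any.++⁺ʳ (map single unvisited) a
      ... | no ¬a | inj₁ v∈ = Any.++⁺ˡ (lose (∈-map⁺ single
              (∈-filter⁺ (λ v → ¬? (Visited? v)) (∈-deduplicate⁺ _≟_ v∈) ¬a)) (zero , refl))
      ... | no ¬a | inj₂ (long , i , k≤ , par) = contradiction
              (Any.concatMap⁺ segments-of (lose (∈-deduplicate⁺ _≟_ (trunk∈around (proj₁ long))) (segments-visit {i = i} long k≤ par (Long? _)))) ¬a

      disjoint : AllPairs DisjointPaths (map single unvisited ++ all-segments)
      disjoint = AllPairs.++⁺
        (AllPairs.map⁺ (AllPairs.map (λ u≢v _ _ → u≢v)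
          (Unique.filter⁺ (λ v → ¬? (Visited? v)) (deduplicate-! _≟_ rest))))
        (AllPairs.concat⁺ (All.map⁺ (All.universal (λ w → segments-self (Long? w)) trunks))
          (AllPairs.map⁺ (AllPairs.map (λ w≢ → segments-disjoint w≢ (Long? _) (Long? _)) (deduplicate-! _≟_ (around G B r)))))
        (All.map⁺ (All.tabulate λ u∈ → All.tabulate λ p∈ i j eq →
          proj₂ (∈-filter⁻ (λ v → ¬? (Visited? v)) {xs = deduplicate _≟_ rest} u∈) (lose p∈ (j , sym eq))))

    ispp-bounded : IsppAtMost G (path-bound Δ n)
    ispp-bounded = ispp-from-list (map single unvisited ++ all-segments)
      (≤-trans (≤-reflexive (length-++ (map single unvisited)))
        (+-mono-≤ (≤-trans (≤-reflexive (length-map single unvisited)) (≤-trans length-unvisited length-rest))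
          -- One segment per trunk, where the common bound allows Δ of them; Δ is positive.
          (≤-trans length-all-segments (*-monoʳ-≤ (Δ ^ B) (ramsey-positive 1≤n)))))
      visit disjoint
      where
      ramsey-positive : ∀ {n} → 1 ≤ n → 1 ≤ ramsey-number n n
      ramsey-positive {suc n} _ = s≤s z≤n

-- Ends of isometric paths and lower bounds

walk-reverse : ∀ {G u v k} → Walk G u v k → Walk G v u k
walk-reverse nil = nil
walk-reverse {G} {k = suc k} (cons a w) = subst (Walk G _ _) (+-comm k 1) (walk-reverse w ++ʷ cons (Adj-sym G a) nil)

hub-connected : ∀ {G} (r : V G) → (∀ u → ∃ λ k → Walk G u r k) → Connected G
hub-connected r to-hub = ≤-<-trans z≤n (toℕ<n r) ,
  λ u v → _ , (proj₂ (to-hub u) ++ʷ walk-reverse (proj₂ (to-hub v)))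

module _ {G : Graph} (p : IsoPath G) where

  vert-adj : ∀ {i j} → toℕ j ≡ suc (toℕ i) → Adj G (vert p i) (vert p j)
  vert-adj {i} {j} eq = subst₂ (λ i j → Adj G (vert p i) (vert p j))
      (toℕ-injective (trans (toℕ-inject₁ k) (toℕ-fromℕ< i<)))
      (toℕ-injective (trans (cong suc (toℕ-fromℕ< i<)) (sym eq))) (step p k)
    where
    i< : toℕ i < len p
    i< = ≤-pred (subst (_< suc (len p)) eq (toℕ<n j))
    k : Fin (len p)
    k = fromℕ< i<

  vert-walk : ∀ d {i j} → toℕ j ≡ d + toℕ i → Walk G (vert p i) (vert p j) d
  vert-walk zero eq with refl ← toℕ-injective eq = nil
  vert-walk (suc d) {i} {j} eq = cons (vert-adj {i} {k} (toℕ-fromℕ< k<)) (vert-walk d {k} {j}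
      (trans eq (trans (sym (+-suc d (toℕ i))) (cong (d +_) (sym (toℕ-fromℕ< k<))))))
    where
    k< : suc (toℕ i) < suc (len p)
    k< = ≤-<-trans (≤-trans (s≤s (m≤n+m (toℕ i) d)) (≤-reflexive (sym eq))) (toℕ<n j)
    k : Fin (suc (len p))
    k = fromℕ< k<

  -- Such an edge would replace two steps of the path by one and give a walk between its ends
  -- shorter than `len p`.
  no-shortcut : ∀ {i j} → toℕ j ≡ 2 + toℕ i → ¬ Adj G (vert p i) (vert p j)
  no-shortcut {i} {j} eq a = <⇒≱ short (shortest p _ (before ++ʷ cons a after))
    where
    rest : ℕ
    rest = len p ∸ toℕ j
    before : Walk G (vert p zero) (vert p i) (toℕ i)
    before = vert-walk (toℕ i) (sym (+-identityʳ (toℕ i)))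
    j+rest : rest + toℕ j ≡ len p
    j+rest = m∸n+n≡m (≤-pred (toℕ<n j))
    after : Walk G (vert p j) (vert p (fromℕ (len p))) rest
    after = vert-walk rest (trans (toℕ-fromℕ (len p)) (sym j+rest))
    short : toℕ i + suc rest < len p
    short = ≤-reflexive (trans (cong suc (trans (+-comm (toℕ i) (suc rest)) (sym (+-suc rest (toℕ i)))))
      (trans (sym (+-suc rest (suc (toℕ i)))) (trans (cong (rest +_) (sym eq)) j+rest)))

  tip : Fin 2 → V G
  tip zero = vert p zero
  tip (suc zero) = vert p (fromℕ (len p))

  record Interior (j : Fin (suc (len p))) : Set where
    field
      before after : Fin (suc (len p))
      before-j     : toℕ j ≡ suc (toℕ before)
      j-after      : toℕ after ≡ suc (toℕ j)

    before-adj : Adj G (vert p before) (vert p j)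
    before-adj = vert-adj before-j

    after-adj : Adj G (vert p j) (vert p after)
    after-adj = vert-adj j-after

    gap : toℕ after ≡ 2 + toℕ before
    gap = trans j-after (cong suc before-j)

    apart : vert p before ≢ vert p after
    apart eq with () ← m≢1+n+m (toℕ before) {1} (trans (cong toℕ (distinct p _ _ eq)) gap)

    not-adj : ¬ Adj G (vert p before) (vert p after)
    not-adj = no-shortcut gap

  tip-or-interior : ∀ j → (∃ λ t → tip t ≡ vert p j) ⊎ Interior j
  tip-or-interior zero = inj₁ (zero , refl)
  tip-or-interior j@(suc i) with toℕ j ℕ.≟ len p
  ... | yes eq = inj₁ (suc zero , cong (vert p) (toℕ-injective (trans (toℕ-fromℕ (len p)) (sym eq))))
  ... | no ≢ = inj₂ record
    { before = inject₁ i
    ; after = fromℕ< j<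
    ; before-j = cong suc (sym (toℕ-inject₁ i))
    ; j-after = toℕ-fromℕ< j<
    }
    where
    j< : suc (toℕ j) < suc (len p)
    j< = s≤s (≤∧≢⇒< (≤-pred (toℕ<n j)) ≢)

module _ {G : Graph} where

  -- u can only be passed by going from l to h or back.
  Bridge : V G → V G → V G → Set
  Bridge u l h = ∀ {a b} → Adj G a u → Adj G u b → a ≢ b → ¬ Adj G a b → (a ≡ l × b ≡ h) ⊎ (a ≡ h × b ≡ l)

  -- These are the simplicial vertices: the neighbourhood is a clique.
  Impassable : V G → Set
  Impassable u = ∀ {a b} → Adj G a u → Adj G u b → a ≢ b → Adj G a b

  impassable-tip : ∀ {m} {P : Fin m → IsoPath G} → IsCover G m P → ∀ {u} → Impassable u → ∃ λ i → ∃ λ t → tip (P i) t ≡ u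
  impassable-tip {P = P} cover {u} imp with cover u
  ... | i , j , refl with tip-or-interior (P i) j
  ...   | inj₁ (t , eq) = i , t , eq
  ...   | inj₂ int = contradiction (imp before-adj after-adj apart) not-adj
    where open Interior int

  -- If both were interior, each would lie between `l` and `h` on its path. Disjointness then makes
  -- the two paths one, and only one vertex of a path can lie between `l` and `h`.
  twin-tip : ∀ {m} {P : Fin m → IsoPath G} → IsCover G m P → IsDisjoint G m P →
    ∀ {u w l h} → u ≢ w → Bridge u l h → Bridge w l h → ∃ λ i → ∃ λ t → tip (P i) t ≡ u ⊎ tip (P i) t ≡ w
  twin-tip {P = P} cover disjoint {u} {w} {l} {h} u≢w bu bw with cover u | cover w
  ... | i , j , refl | i′ , j′ , refl with tip-or-interior (P i) j | tip-or-interior (P i′) j′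
  ...   | inj₁ (t , eq) | _ = i , t , inj₁ eq
  ...   | inj₂ _ | inj₁ (t , eq) = i′ , t , inj₂ eq
  ...   | inj₂ int | inj₂ int′ = ⊥-elim (same-path (disjoint i i′ _ _ (proj₂ (proj₂ meet))))
    where
    open Interior int
    open Interior int′ renaming (before to before′; after to after′; before-j to before-j′; j-after to j-after′;
      before-adj to before-adj′; after-adj to after-adj′; gap to gap′; apart to apart′; not-adj to not-adj′)
    passes : (vert (P i) before ≡ l × vert (P i) after ≡ h) ⊎ (vert (P i) before ≡ h × vert (P i) after ≡ l)
    passes = bu before-adj after-adj apart not-adj
    passes′ : (vert (P i′) before′ ≡ l × vert (P i′) after′ ≡ h) ⊎ (vert (P i′) before′ ≡ h × vert (P i′) after′ ≡ l)
    passes′ = bw before-adj′ after-adj′ apart′ not-adj′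
    meet : ∃ λ a → ∃ λ b → vert (P i) a ≡ vert (P i′) b
    meet with passes | passes′
    ... | inj₁ (eq , _) | inj₁ (eq′ , _) = before , before′ , trans eq (sym eq′)
    ... | inj₁ (eq , _) | inj₂ (_ , eq′) = before , after′ , trans eq (sym eq′)
    ... | inj₂ (_ , eq) | inj₁ (eq′ , _) = after , before′ , trans eq (sym eq′)
    ... | inj₂ (_ , eq) | inj₂ (_ , eq′) = after , after′ , trans eq (sym eq′)
    index : ∀ {a b v} → i ≡ i′ → vert (P i) a ≡ v → vert (P i′) b ≡ v → toℕ a ≡ toℕ b
    index refl eq eq′ = cong toℕ (distinct (P i) _ _ (trans eq (sym eq′)))
    same-index : i ≡ i′ → toℕ j ≡ toℕ j′
    same-index i≡ with passes | passes′
    ... | inj₁ (eq , _) | inj₁ (eq′ , _) = trans before-j (trans (cong suc (index i≡ eq eq′)) (sym before-j′))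
    ... | inj₂ (eq , _) | inj₂ (eq′ , _) = trans before-j (trans (cong suc (index i≡ eq eq′)) (sym before-j′))
    -- Opposite orientations: on a single path `h` would be two positions after `l` and also two
    -- before it.
    ... | inj₁ (el , eh) | inj₂ (eh′ , el′) = contradiction
      (trans (index i≡ el el′) (trans gap′ (cong (2 +_) (trans (sym (index i≡ eh eh′)) gap)))) (m≢1+n+m _)
    ... | inj₂ (eh , el) | inj₁ (el′ , eh′) = contradiction
      (trans (index i≡ eh eh′) (trans gap′ (cong (2 +_) (trans (sym (index i≡ el el′)) gap)))) (m≢1+n+m _)
    same-path : i ≡ i′ → ⊥
    same-path refl = u≢w (cong (vert (P i)) (toℕ-injective (same-index refl)))

  -- Each path has two tips, so m paths account for at most 2m indices.
  tips-bound : ∀ {m N} {P : Fin m → IsoPath G} (Own : V G → Fin N → Set) → (∀ {v j j′} → Own v j → Own v j′ → j ≡ j′) →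
    (∀ j → ∃ λ i → ∃ λ t → Own (tip (P i) t) j) → N ≤ m * 2
  tips-bound {m} {N} {P} Own unique own = injective⇒≤ {f = f} inj
    where
    f : Fin N → Fin (m * 2)
    f j = combine (proj₁ (own j)) (proj₁ (proj₂ (own j)))
    inj : ∀ {j j′} → f j ≡ f j′ → j ≡ j′
    inj {j} {j′} eq with own j | own j′ | combine-injective (proj₁ (own j)) (proj₁ (proj₂ (own j))) (proj₁ (own j′)) (proj₁ (proj₂ (own j′))) eq
    ... | _ , _ , o | _ , _ , o′ | refl , refl = unique o o′

  ispc-lower : ∀ {N c} (s : Fin N → V G) → (∀ {i j} → s i ≡ s j → i ≡ j) → (∀ j → Impassable (s j)) →
    IspcAtMost G c → N ≤ c * 2
  ispc-lower s s-inj imp (m , m≤c , P , cover) = ≤-trans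
    (tips-bound {P = P} (λ v j → v ≡ s j) (λ eq eq′ → s-inj (trans (sym eq) eq′)) (λ j → impassable-tip cover (imp j)))
    (*-monoˡ-≤ 2 m≤c)

IsppAtMost⇒IspcAtMost : ∀ {G c} → IsppAtMost G c → IspcAtMost G c
IsppAtMost⇒IspcAtMost (m , m≤c , P , cover , _) = m , m≤c , P , cover

-- Complete graphs and stars

K-adj : ∀ {n} {u v : Fin n} → u ≢ v → Adj (K n) u v
K-adj {n} u≢v = mkGraph-adj {n} {λ _ _ → true} u≢v

K-connected : ∀ {n} → 1 ≤ n → Connected (K n)
K-connected {suc n} _ = hub-connected {K (suc n)} zero to-hub
  where
  to-hub : ∀ u → ∃ λ k → Walk (K (suc n)) u zero k
  to-hub zero = 0 , nil
  to-hub (suc u) = 1 , cons (K-adj {suc n} {suc u} {zero} λ ()) nil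

K-ispc-lower : ∀ {n c} → IspcAtMost (K n) c → n ≤ c * 2
K-ispc-lower {n} = ispc-lower {K n} (λ j → j) (λ eq → eq) (λ j _ _ a≢b → K-adj a≢b)

K1-connected : ∀ n → Connected (K1 n)
K1-connected n = hub-connected {K1 n} zero to-hub
  where
  to-hub : ∀ u → ∃ λ k → Walk (K1 n) u zero k
  to-hub zero = 0 , nil
  to-hub (suc u) = 1 , cons refl nil

K1-leaf : ∀ {n} (u : V (K1 n)) j → Adj (K1 n) u (suc j) → u ≡ zero
K1-leaf zero j _ = refl
K1-leaf {n} (suc i) j a with i ≟ j
... | yes _ with () ← a
... | no _ with () ← a

K1-ispc-lower : ∀ {n c} → IspcAtMost (K1 n) c → n ≤ c * 2
K1-ispc-lower {n} = ispc-lower {K1 n} suc (λ { refl → refl })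
  λ j {a} {b} p q a≢b → contradiction (trans (K1-leaf a j p) (sym (K1-leaf b j (Adj-sym (K1 n) {suc j} {b} q)))) a≢b

-- Combs

Touch? : ∀ π c i → Dec (Touch π c i)
Touch? π c i = ((Pattern.lo π Bool.≟ true) ×-dec (suc i ℕ.≟ c)) ⊎-dec
  (((Pattern.mid π Bool.≟ true) ×-dec (i ℕ.≟ c)) ⊎-dec ((Pattern.hi π Bool.≟ true) ×-dec (i ℕ.≟ suc c)))

-- A path with positions 0, …, M (n + 2) - 1 and M apexes, the a-th of which touches the path
-- around its centre a (n + 2) + n according to the pattern.
module Comb (π : Pattern) (lo-or-mid : Pattern.lo π ≡ true ⊎ Pattern.mid π ≡ true) (n : ℕ) (1≤n : 1 ≤ n) (M : ℕ) where

  -- Each tooth has `n + 2` positions of its own: n before the centre, the centre, and one after it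
  -- for patterns with `hi`. Thus distinct centres are more than n apart.
  spacing teeth : ℕ
  spacing = 2 + n
  teeth = M * spacing

  Coord : Set
  Coord = Fin teeth ⊎ Fin M

  centre : Fin M → ℕ
  centre a = toℕ a * spacing + n

  centre< : ∀ a → suc (centre a) < teeth
  centre< a = ≤-trans (≤-reflexive (cong (2 +_) (+-comm (toℕ a * spacing) n))) (*-monoˡ-≤ spacing (toℕ<n a))

  Joined : Coord → Coord → Set
  Joined (inj₁ i) (inj₁ j) = suc (toℕ i) ≡ toℕ j ⊎ suc (toℕ j) ≡ toℕ i
  Joined (inj₁ i) (inj₂ a) = Touch π (centre a) (toℕ i)
  Joined (inj₂ a) (inj₁ i) = Touch π (centre a) (toℕ i)
  Joined (inj₂ _) (inj₂ _) = ⊥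

  Joined? : ∀ s t → Dec (Joined s t)
  Joined? (inj₁ i) (inj₁ j) = (suc (toℕ i) ℕ.≟ toℕ j) ⊎-dec (suc (toℕ j) ℕ.≟ toℕ i)
  Joined? (inj₁ i) (inj₂ a) = Touch? π (centre a) (toℕ i)
  Joined? (inj₂ a) (inj₁ i) = Touch? π (centre a) (toℕ i)
  Joined? (inj₂ _) (inj₂ _) = no λ ()

  Joined-sym : ∀ s t → Joined s t → Joined t s
  Joined-sym (inj₁ i) (inj₁ j) = swap
  Joined-sym (inj₁ i) (inj₂ a) t = t
  Joined-sym (inj₂ a) (inj₁ i) t = t

  Joined-irrefl : ∀ s → ¬ Joined s s
  Joined-irrefl (inj₁ i) (inj₁ eq) = 1+n≢n eq
  Joined-irrefl (inj₁ i) (inj₂ eq) = 1+n≢n eq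

  coord : Fin (teeth + M) → Coord
  coord = splitAt teeth

  joined : Fin (teeth + M) → Fin (teeth + M) → Bool
  joined u v = does (Joined? (coord u) (coord v))

  does⁺ : ∀ {A : Set} {d : Dec A} → A → does d ≡ true
  does⁺ {d = d} = dec-true d

  does⁻ : ∀ {A : Set} {d : Dec A} → does d ≡ true → A
  does⁻ {d = yes a} _ = a

  comb : Graph
  comb = record
    { size = teeth + M
    ; adj = joined
    ; adj-sym = λ u v → Bool.⇔→≡ (mk⇔ (flip u v) (flip v u))
    ; adj-irrefl = λ u → Bool.¬-not λ eq → Joined-irrefl (coord u) (does⁻ {d = Joined? (coord u) (coord u)} eq)
    }
    where
    flip : ∀ u v → joined u v ≡ true → joined v u ≡ true
    flip u v eq = does⁺ {d = Joined? (coord v) (coord u)}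
      (Joined-sym (coord u) (coord v) (does⁻ {d = Joined? (coord u) (coord v)} eq))

  uncoord : Coord → V comb
  uncoord = join teeth M

  coord-uncoord : ∀ s → coord (uncoord s) ≡ s
  coord-uncoord = splitAt-join teeth M

  coord-inj : ∀ {u v} → coord u ≡ coord v → u ≡ v
  coord-inj {u} {v} eq = trans (sym (join-splitAt teeth M u)) (trans (cong uncoord eq) (join-splitAt teeth M v))

  adj⇒joined : ∀ {u v} → Adj comb u v → Joined (coord u) (coord v)
  adj⇒joined {u} {v} = does⁻ {d = Joined? (coord u) (coord v)}

  joined⇒adj : ∀ {u v} → Joined (coord u) (coord v) → Adj comb u v
  joined⇒adj {u} {v} = does⁺ {d = Joined? (coord u) (coord v)}

  uncoord-adj : ∀ {s t} → Joined s t → Adj comb (uncoord s) (uncoord t)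
  uncoord-adj {s} {t} j = joined⇒adj (subst₂ Joined (sym (coord-uncoord s)) (sym (coord-uncoord t)) j)

  -- Projecting an apex to its centre keeps adjacent vertices within one of each other, so distances
  -- in the comb bound differences of positions.
  height-of : Coord → ℕ
  height-of (inj₁ i) = toℕ i
  height-of (inj₂ a) = centre a

  pos : V comb → ℕ
  pos u = height-of (coord u)

  pos-lipschitz : Lipschitz {comb} pos
  pos-lipschitz {u} {v} a = bound (coord u) (coord v) (adj⇒joined {u} {v} a)
    where
    touch-near : ∀ {c i} → Touch π c i → i ≤ suc c × c ≤ suc i
    touch-near (inj₁ (_ , refl)) = ≤-trans (n≤1+n _) (n≤1+n _) , ≤-refl
    touch-near (inj₂ (inj₁ (_ , refl))) = n≤1+n _ , n≤1+n _
    touch-near (inj₂ (inj₂ (_ , refl))) = ≤-refl , ≤-trans (n≤1+n _) (n≤1+n _)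
    bound : ∀ s t → Joined s t → height-of s ≤ suc (height-of t)
    bound (inj₁ i) (inj₁ j) (inj₁ eq) = ≤-trans (n≤1+n _) (≤-trans (≤-reflexive eq) (n≤1+n _))
    bound (inj₁ i) (inj₁ j) (inj₂ eq) = ≤-reflexive (sym eq)
    bound (inj₁ i) (inj₂ a) t = proj₁ (touch-near t)
    bound (inj₂ a) (inj₁ i) t = proj₂ (touch-near t)

  centre-close : ∀ {a b} → centre a < n + centre b → centre b < n + centre a → a ≡ b
  centre-close {a} {b} ab ba = toℕ-injective (≤-antisym (le {a} {b} ab) (le {b} {a} ba))
    where
    le : ∀ {a b} → centre a < n + centre b → toℕ a ≤ toℕ b
    le {a} {b} ab = ≮⇒≥ λ b<a → <⇒≱ ab (≤-trans (+-monoˡ-≤ (centre b) (m≤n+m n 2))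
      (≤-trans (≤-reflexive (sym (+-assoc spacing (toℕ b * spacing) n))) (+-monoˡ-≤ n (*-monoˡ-≤ spacing b<a))))

  centre-inj : ∀ {a b} → centre a ≡ centre b → a ≡ b
  centre-inj {a} {b} eq = centre-close (subst (_< n + centre b) (sym eq) (m<n+m (centre b) 1≤n))
    (subst (_< n + centre a) eq (m<n+m (centre a) 1≤n))

  module _ (zero-pos : Fin teeth) (zero-pos-0 : toℕ zero-pos ≡ 0) where

    to-zero : ∀ k {i : Fin teeth} → toℕ i ≡ k → Walk comb (uncoord (inj₁ i)) (uncoord (inj₁ zero-pos)) k
    to-zero zero eq with refl ← toℕ-injective (trans eq (sym zero-pos-0)) = nil
    to-zero (suc k) {i} eq = cons (uncoord-adj {inj₁ i} {inj₁ j} (inj₂ (trans (cong suc (toℕ-fromℕ< k<)) (sym eq))))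
      (to-zero k {j} (toℕ-fromℕ< k<))
      where
      k< : k < teeth
      k< = ≤-trans (≤-reflexive (sym eq)) (<⇒≤ (toℕ<n i))
      j : Fin teeth
      j = fromℕ< k<

    -- The use of `lo-or-mid`: it attaches every apex to the path. The predecessor of a centre
    -- exists because `1 ≤ n`.
    touched : ∀ a → ∃ λ i → Touch π (centre a) (toℕ {teeth} i)
    touched a = [ at-lo , (λ m → fromℕ< c< , inj₂ (inj₁ (m , toℕ-fromℕ< c<))) ]′ lo-or-mid
      where
      c< : centre a < teeth
      c< = <⇒≤ (centre< a)
      suc-pred-centre : suc (pred (centre a)) ≡ centre a
      suc-pred-centre = suc-pred (centre a) {{ℕ.>-nonZero (≤-trans 1≤n (m≤n+m n (toℕ a * spacing)))}}
      p< : pred (centre a) < teeth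
      p< = ≤-trans (≤-reflexive suc-pred-centre) (<⇒≤ c<)
      at-lo : Pattern.lo π ≡ true → ∃ λ i → Touch π (centre a) (toℕ {teeth} i)
      at-lo l = fromℕ< p< , inj₁ (l , trans (cong suc (toℕ-fromℕ< p<)) suc-pred-centre)

    to-zero-coord : ∀ s → ∃ λ k → Walk comb (uncoord s) (uncoord (inj₁ zero-pos)) k
    to-zero-coord (inj₁ i) = toℕ i , to-zero (toℕ i) refl
    to-zero-coord (inj₂ a) with touched a
    ... | i , t = _ , cons (uncoord-adj {inj₂ a} {inj₁ i} t) (to-zero (toℕ i) refl)

    connected-from-zero : Connected comb
    connected-from-zero = hub-connected {comb} (uncoord (inj₁ zero-pos)) λ u →
      let k , w = to-zero-coord (coord u) in k , subst (λ v → Walk comb v _ k) (join-splitAt teeth M u) w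

  comb-connected : 1 ≤ M → Connected comb
  comb-connected 1≤M = connected-from-zero (fromℕ< 0<) (toℕ-fromℕ< 0<)
    where
    0< : 0 < teeth
    0< = *-mono-≤ 1≤M (s≤s {n = suc n} z≤n)

  -- The image of a small connected graph lies within distance < n of one of its vertices, chosen to be an apex if possible.
  module _ {F} (R : Realisation n π F) {H} (connected : Connected H) (size≤n : size H ≤ n)
    (f : V H → V comb) (f-inj : ∀ i j → f i ≡ f j → i ≡ j) (f-adj : ∀ i j → adj comb (f i) (f j) ≡ adj H i j) where

    private
      module Reach (h₀ : V H) where
        open Rooted H connected h₀ using (depth; depth-walk; depth<size)

        lip : Lipschitz {H} (λ h → pos (f h))
        lip {u} {v} a = pos-lipschitz {f u} {f v} (trans (f-adj u v) a)

        below : ∀ h → pos (f h) < n + pos (f h₀)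
        below h = ≤-<-trans (walk-lipschitz (λ h → pos (f h)) lip (depth-walk h))
          (+-monoˡ-< (pos (f h₀)) (<-≤-trans (depth<size h) size≤n))

        above : ∀ h → pos (f h₀) < n + pos (f h)
        above h = ≤-<-trans (walk-lipschitz (λ h → pos (f h)) lip (walk-reverse (depth-walk h)))
          (+-monoˡ-< (pos (f h)) (<-≤-trans (depth<size h) size≤n))

      -- `own` places every apex of the image over the position of `h₀`, so a single apex of F can
      -- stand for it.
      module Shifted (h₀ : V H) (own : ∀ h {a} → coord (f h) ≡ inj₂ a → centre a ≡ pos (f h₀)) where
        open Reach h₀

        b : ℕ
        b = pos (f h₀)

        shift : Coord → Maybe ℕ
        -- Moves the position of `h₀` to n. All positions of the image are less than n away from it,
        -- so the subtraction is not truncated and the result is below `n + n`.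
        shift (inj₁ i) = just (n + toℕ i ∸ b)
        shift (inj₂ _) = nothing

        b≤ : ∀ h {i} → coord (f h) ≡ inj₁ i → b ≤ n + toℕ i
        b≤ h eq = ≤-trans (<⇒≤ (above h)) (≤-reflexive (cong (λ s → n + height-of s) eq))

        shift-inj : ∀ h h′ {s t} → coord (f h) ≡ s → coord (f h′) ≡ t → shift s ≡ shift t → s ≡ t
        shift-inj h h′ {inj₁ i} {inj₁ j} eq eq′ e = cong inj₁ (toℕ-injective (+-cancelˡ-≡ n _ _
          (∸-cancelʳ-≡ (b≤ h eq) (b≤ h′ eq′) (just-injective e))))
        shift-inj h h′ {inj₂ a} {inj₂ a′} eq eq′ e = cong inj₂ (centre-inj (trans (own h eq) (sym (own h′ eq′))))

        shift-bound : ∀ h {s i} → coord (f h) ≡ s → shift s ≡ just i → i < n + n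
        shift-bound h {inj₁ i} eq refl = +-cancelʳ-< b _ _ (<-≤-trans (≤-<-trans (≤-reflexive (m∸n+n≡m (b≤ h eq)))
            (+-monoʳ-< n (≤-<-trans (≤-reflexive (cong height-of (sym eq))) (below h)))) (≤-reflexive (sym (+-assoc n n b))))

        back : ∀ h {i} → coord (f h) ≡ inj₁ i → b + (n + toℕ i ∸ b) ≡ n + toℕ i
        back h eq = m+[n∸m]≡n (b≤ h eq)

        step⇔ : ∀ h h′ {i j} → coord (f h) ≡ inj₁ i → coord (f h′) ≡ inj₁ j →
          suc (toℕ i) ≡ toℕ j ⇔ suc (n + toℕ i ∸ b) ≡ n + toℕ j ∸ b
        step⇔ h h′ {i} {j} eq eq′ = mk⇔
          (λ e → +-cancelˡ-≡ b _ _ (trans (+-suc b _) (trans (cong suc (back h eq))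
             (trans (sym (+-suc n (toℕ i))) (trans (cong (n +_) e) (sym (back h′ eq′)))))))
          (λ e → +-cancelˡ-≡ n _ _ (trans (+-suc n (toℕ i)) (trans (cong suc (sym (back h eq)))
             (trans (sym (+-suc b _)) (trans (cong (b +_) e) (back h′ eq′))))))

        touch⇔ : ∀ h {i c} → coord (f h) ≡ inj₁ i → c ≡ b → Touch π c (toℕ i) ⇔ Touch π n (n + toℕ i ∸ b)
        touch⇔ h {i} eq refl = mk⇔
          (λ t → Touch-unshift {s = b} (subst₂ (Touch π) (+-comm n b) (sym (back h eq)) (Touch-shift {s = n} t)))
          (λ t → Touch-unshift {s = n} (subst₂ (Touch π) (+-comm b n) (back h eq) (Touch-shift {s = b} t)))

        shift-joined : ∀ h h′ {s t} → coord (f h) ≡ s → coord (f h′) ≡ t → Joined s t ⇔ Link π n (shift s) (shift t)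
        shift-joined h h′ {inj₁ i} {inj₁ j} eq eq′ = mk⇔
            [ (λ e → inj₁ (to (step⇔ h h′ eq eq′) e)) , (λ e → inj₂ (to (step⇔ h′ h eq′ eq) e)) ]′
            [ (λ e → inj₁ (from (step⇔ h h′ eq eq′) e)) , (λ e → inj₂ (from (step⇔ h′ h eq′ eq) e)) ]′
          where open Equivalence
        shift-joined h h′ {inj₁ i} {inj₂ a} eq eq′ = touch⇔ h eq (own h′ eq′)
        shift-joined h h′ {inj₂ a} {inj₁ i} eq eq′ = touch⇔ h′ eq′ (own h eq)
        shift-joined h h′ {inj₂ _} {inj₂ _} _ _ = mk⇔ (λ ()) (λ ())

        embedded : H ⊑ F
        embedded = ⊑-realised R {H} (λ h → shift (coord (f h)))
          (λ {u} {v} eq → f-inj u v (coord-inj (shift-inj u v refl refl eq)))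
          (λ {u} → shift-bound u refl)
          (λ {u} {v} → mk⇔
            (λ a → to (shift-joined u v refl refl) (adj⇒joined {f u} {f v} (trans (f-adj u v) a)))
            (λ l → trans (sym (f-adj u v)) (joined⇒adj {f u} {f v} (from (shift-joined u v refl refl) l))))
          where open Equivalence

    localise : H ⊑ F
    localise with any? (λ h → is-apex? (coord (f h)))
      where
      is-apex? : ∀ s → Dec (∃ λ a → s ≡ inj₂ {A = Fin teeth} {B = Fin M} a)
      is-apex? (inj₁ _) = no λ ()
      is-apex? (inj₂ a) = yes (a , refl)
    -- Any other apex in the image would have its centre less than n away, which the spacing rules
    -- out.
    ... | yes (h₀ , a₀ , eq₀) = Shifted.embedded h₀ λ h {a} eq →
      trans (cong centre (centre-close {a} {a₀}
        (subst₂ (λ s t → height-of s < n + height-of t) eq eq₀ (Reach.below h₀ h))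
        (subst₂ (λ s t → height-of s < n + height-of t) eq₀ eq (Reach.above h₀ h)))) (cong height-of (sym eq₀))
    ... | no none = Shifted.embedded (fromℕ< (proj₁ connected)) λ h {a} eq → contradiction (h , a , eq) none

  comb-localise : ∀ {F} → Realisation n π F → ∀ {H} → Connected H → size H ≤ n → H ⊑ comb → H ⊑ F
  comb-localise R connected size≤n (f , f-inj , f-adj) = localise R connected size≤n f f-inj f-adj

  apex : Fin M → V comb
  apex a = uncoord (inj₂ a)

  uncoord-inj : ∀ {s t} → uncoord s ≡ uncoord t → s ≡ t
  uncoord-inj {s} {t} eq = trans (sym (coord-uncoord s)) (trans (cong coord eq) (coord-uncoord t))

  apex-inj : ∀ {a b} → apex a ≡ apex b → a ≡ b
  apex-inj eq = inj₂-injective (uncoord-inj eq)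

  neighbour-coord : ∀ {v s} → Adj comb v (uncoord s) → ∃ λ t → v ≡ uncoord t × Joined t s
  neighbour-coord {v} {s} a = coord v , sym (join-splitAt teeth M v) ,
    subst (Joined (coord v)) (coord-uncoord s) (adj⇒joined {v} {uncoord s} a)

  same-position : ∀ {i j : Fin teeth} → toℕ i ≡ toℕ j → uncoord (inj₁ i) ≡ uncoord (inj₁ j)
  same-position eq = cong (λ i → uncoord (inj₁ i)) (toℕ-injective eq)

  -- Without `hi` an apex can touch only the centre and the position before it, and these two are
  -- adjacent.
  apex-impassable : Pattern.hi π ≡ false → ∀ a → Impassable {comb} (apex a)
  apex-impassable no-hi a p q v≢w
    with neighbour-coord {s = inj₂ a} p | neighbour-coord {s = inj₂ a} (Adj-sym comb {apex a} q)
  ... | inj₁ i , refl , t | inj₁ j , refl , t′ = uncoord-adj {inj₁ i} {inj₁ j} (consecutive t t′)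
    where
    no-hi′ : ∀ {A : Set} → Pattern.hi π ≡ true → A
    no-hi′ hi with () ← trans (sym hi) no-hi
    consecutive : Touch π (centre a) (toℕ i) → Touch π (centre a) (toℕ j) → suc (toℕ i) ≡ toℕ j ⊎ suc (toℕ j) ≡ toℕ i
    consecutive (inj₁ (_ , e)) (inj₁ (_ , e′)) = contradiction (same-position (suc-injective (trans e (sym e′)))) v≢w
    consecutive (inj₁ (_ , e)) (inj₂ (inj₁ (_ , e′))) = inj₁ (trans e (sym e′))
    consecutive (inj₂ (inj₁ (_ , e))) (inj₁ (_ , e′)) = inj₂ (trans e′ (sym e))
    consecutive (inj₂ (inj₁ (_ , e))) (inj₂ (inj₁ (_ , e′))) = contradiction (same-position (trans e (sym e′))) v≢w
    consecutive (inj₂ (inj₂ (hi , _))) _ = no-hi′ hi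
    consecutive _ (inj₂ (inj₂ (hi , _))) = no-hi′ hi

  comb-ispc-lower : ∀ {c} → Pattern.hi π ≡ false → IspcAtMost comb c → M ≤ c * 2
  comb-ispc-lower no-hi = ispc-lower {comb} apex apex-inj (apex-impassable no-hi)

  module _ (lo : Pattern.lo π ≡ true) (hi : Pattern.hi π ≡ true) (2≤n : 2 ≤ n) where

    private
      module Tooth (a : Fin M) where
        c : ℕ
        c = centre a

        c< : c < teeth
        c< = <⇒≤ (centre< a)

        suc-pred-c : suc (pred c) ≡ c
        suc-pred-c = suc-pred c {{ℕ.>-nonZero (≤-trans 1≤n (m≤n+m n (toℕ a * spacing)))}}

        p< : pred c < teeth
        p< = ≤-trans (≤-reflexive suc-pred-c) (<⇒≤ c<)

        il im ih : Fin teeth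
        il = fromℕ< p<
        im = fromℕ< c<
        ih = fromℕ< (centre< a)

        l w h : V comb
        l = uncoord (inj₁ il)
        w = uncoord (inj₁ im)
        h = uncoord (inj₁ ih)

        toℕ-il : suc (toℕ il) ≡ c
        toℕ-il = trans (cong suc (toℕ-fromℕ< p<)) suc-pred-c

        toℕ-im : toℕ im ≡ c
        toℕ-im = toℕ-fromℕ< c<

        toℕ-ih : toℕ ih ≡ suc c
        toℕ-ih = toℕ-fromℕ< (centre< a)

        Among : V comb → V comb → Set
        Among q v = v ≡ l ⊎ v ≡ h ⊎ v ≡ q

        -- The third possible neighbour `q` is adjacent to both `l` and `h`, so a non-adjacent pair
        -- of neighbours can only be `l` and `h`. It is used with the apex and the centre as `u` and
        -- `q`, in both orders.
        bridge : ∀ {u q} → (∀ v → Adj comb v u → Among q v) → Adj comb q l → Adj comb q h → Bridge {comb} u l h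
        bridge {u} {q} among ql qh {v} {v′} p p′ v≢ ¬adj with among v p | among v′ (Adj-sym comb {u} {v′} p′)
        ... | inj₁ e | inj₁ e′ = contradiction (trans e (sym e′)) v≢
        ... | inj₁ e | inj₂ (inj₁ e′) = inj₁ (e , e′)
        ... | inj₁ refl | inj₂ (inj₂ refl) = contradiction (Adj-sym comb {q} {l} ql) ¬adj
        ... | inj₂ (inj₁ e) | inj₁ e′ = inj₂ (e , e′)
        ... | inj₂ (inj₁ e) | inj₂ (inj₁ e′) = contradiction (trans e (sym e′)) v≢
        ... | inj₂ (inj₁ refl) | inj₂ (inj₂ refl) = contradiction (Adj-sym comb {q} {h} qh) ¬adj
        ... | inj₂ (inj₂ refl) | inj₁ refl = contradiction ql ¬adj
        ... | inj₂ (inj₂ refl) | inj₂ (inj₁ refl) = contradiction qh ¬adj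
        ... | inj₂ (inj₂ e) | inj₂ (inj₂ e′) = contradiction (trans e (sym e′)) v≢

        apex-among : ∀ v → Adj comb v (apex a) → Among w v
        apex-among v p with neighbour-coord {v} {inj₂ a} p
        ... | inj₁ i , refl , inj₁ (_ , e) = inj₁ (same-position (suc-injective (trans e (sym toℕ-il))))
        ... | inj₁ i , refl , inj₂ (inj₁ (_ , e)) = inj₂ (inj₂ (same-position (trans e (sym toℕ-im))))
        ... | inj₁ i , refl , inj₂ (inj₂ (_ , e)) = inj₂ (inj₁ (same-position (trans e (sym toℕ-ih))))

        touching-apex : ∀ {a′} → Touch π (centre a′) c → a′ ≡ a
        touching-apex {a′} t = centre-close {a′} {a} (≤-trans (s≤s (proj₁ (spread t))) (+-monoˡ-≤ c 2≤n))
            (≤-trans (s≤s (proj₂ (spread t))) (+-monoˡ-≤ (centre a′) 2≤n))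
          where
          spread : ∀ {d} → Touch π d c → d ≤ suc c × c ≤ suc d
          spread (inj₁ (_ , refl)) = ≤-refl , ≤-trans (n≤1+n _) (n≤1+n _)
          spread (inj₂ (inj₁ (_ , refl))) = n≤1+n _ , n≤1+n _
          spread (inj₂ (inj₂ (_ , e))) = ≤-trans (≤-trans (n≤1+n _) (≤-reflexive (sym e))) (n≤1+n _) , ≤-reflexive e

        w-among : ∀ v → Adj comb v w → Among (apex a) v
        w-among v p with neighbour-coord {v} {inj₁ im} p
        ... | inj₁ i , refl , inj₁ e = inj₁ (same-position (suc-injective (trans e (trans toℕ-im (sym toℕ-il)))))
        ... | inj₁ i , refl , inj₂ e = inj₂ (inj₁ (same-position (trans (sym e) (trans (cong suc toℕ-im) (sym toℕ-ih)))))
        ... | inj₂ a′ , refl , t with refl ← touching-apex {a′} (subst (Touch π (centre a′)) toℕ-im t) = inj₂ (inj₂ refl)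

        apex-bridge : Bridge {comb} (apex a) l h
        apex-bridge = bridge apex-among (uncoord-adj {inj₁ im} {inj₁ il} (inj₂ (trans toℕ-il (sym toℕ-im))))
          (uncoord-adj {inj₁ im} {inj₁ ih} (inj₁ (trans (cong suc toℕ-im) (sym toℕ-ih))))

        w-bridge : Bridge {comb} w l h
        w-bridge = bridge w-among (uncoord-adj {inj₂ a} {inj₁ il} (inj₁ (lo , toℕ-il)))
          (uncoord-adj {inj₂ a} {inj₁ ih} (inj₂ (inj₂ (hi , toℕ-ih))))

    -- In every tooth the apex or the centre vertex is a tip, and different teeth have different
    -- such vertices.
    comb-ispp-lower : ∀ {c} → IsppAtMost comb c → M ≤ c * 2
    comb-ispp-lower (m , m≤c , P , cover , disjoint) = ≤-trans
        (tips-bound {comb} {P = P} Own unique λ j →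
          twin-tip {comb} {P = P} cover disjoint {apex j} {Tooth.w j} (λ eq → apex≢position (uncoord-inj eq)) (Tooth.apex-bridge j) (Tooth.w-bridge j))
        (*-monoˡ-≤ 2 m≤c)
      where
      Own : V comb → Fin M → Set
      Own v j = v ≡ apex j ⊎ v ≡ Tooth.w j
      apex≢position : ∀ {a i} → _≢_ {A = Coord} (inj₂ a) (inj₁ i)
      apex≢position ()
      unique : ∀ {v j j′} → Own v j → Own v j′ → j ≡ j′
      unique (inj₁ e) (inj₁ e′) = apex-inj (trans (sym e) e′)
      unique (inj₁ e) (inj₂ e′) = contradiction (uncoord-inj (trans (sym e) e′)) apex≢position
      unique (inj₂ e) (inj₁ e′) = contradiction (uncoord-inj (trans (sym e′) e)) apex≢position
      unique {j = j} {j′} (inj₂ e) (inj₂ e′) = centre-inj (trans (sym (Tooth.toℕ-im j))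
        (trans (cong toℕ (inj₁-injective (uncoord-inj (trans (sym e) e′)))) (Tooth.toℕ-im j′)))

-- Assembling the two equivalences

∈⇒≤sum : ∀ {A : Set} (g : A → ℕ) {a as} → a ∈ as → g a ≤ sum (map g as)
∈⇒≤sum g (here refl) = m≤m+n _ _
∈⇒≤sum g {as = b ∷ _} (there a∈) = ≤-trans (∈⇒≤sum g a∈) (m≤n+m _ (g b))

Bounded : (Graph → ℕ → Set) → List Graph → ℕ → Set
Bounded AtMost ℋ c = ∀ G → Connected G → Free ℋ G → AtMost G c

forbidden-by : ∀ {ℋ F G} → Any (_⊑ F) ℋ → Free ℋ G → ¬ F ⊑ G
forbidden-by {ℋ} {F} {G} any free F⊑G with find any
... | H , H∈ , H⊑F = All.lookup free H∈ (⊑-trans {H} {F} {G} H⊑F F⊑G)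

module Necessity (ℋ : List Graph) (connected : All Connected ℋ) (c n : ℕ) (2≤n : 2 ≤ n)
  (n> : ¬ n ≤ c * 2) (size≤n : ∀ {H} → H ∈ ℋ → size H ≤ n) where

  private
    1≤n : 1 ≤ n
    1≤n = <⇒≤ 2≤n

  module _ {AtMost : Graph → ℕ → Set} (bounded : Bounded AtMost ℋ c) where

    unbounded⇒Any⊑ : ∀ {G} → Connected G → ¬ AtMost G c → Any (_⊑ G) ℋ
    unbounded⇒Any⊑ {G} conn large = ¬Free⇒Any⊑ {ℋ} {G} λ free → large (bounded G conn free)

    module _ {π F} (lo-or-mid : Pattern.lo π ≡ true ⊎ Pattern.mid π ≡ true) (R : Realisation n π F) where
      open Comb π lo-or-mid n 1≤n n

      -- The member found in the comb is connected and has at most n vertices, so it fits around a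
      -- single tooth and hence into F.
      comb-unbounded⇒Any⊑ : ¬ AtMost comb c → Any (_⊑ F) ℋ
      comb-unbounded⇒Any⊑ large with find (unbounded⇒Any⊑ {comb} (comb-connected 1≤n) large)
      ... | H , H∈ , H⊑ = lose H∈ (comb-localise R {H} (All.lookup connected H∈) (size≤n H∈) H⊑)

    ispc-necessary : (∀ {G} → AtMost G c → IspcAtMost G c) → ℋ ≼ (K n ∷ K1 n ∷ F1 n ∷ F2 n ∷ [])
    ispc-necessary ⇒ispc =
      unbounded⇒Any⊑ {K n} (K-connected 1≤n) (λ b → n> (K-ispc-lower (⇒ispc b))) ∷
      unbounded⇒Any⊑ {K1 n} (K1-connected n) (λ b → n> (K1-ispc-lower (⇒ispc b))) ∷
      comb-unbounded⇒Any⊑ (inj₂ refl) (F1-realisation n)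
        (λ b → n> (Comb.comb-ispc-lower onlyMid (inj₂ refl) n 1≤n n refl (⇒ispc b))) ∷
      comb-unbounded⇒Any⊑ (inj₁ refl) (F2-realisation n)
        (λ b → n> (Comb.comb-ispc-lower loMid (inj₁ refl) n 1≤n n refl (⇒ispc b))) ∷ []

  module _ (bounded : Bounded IsppAtMost ℋ c) where

    ispp-necessary : ℋ ≼ (K n ∷ K1 n ∷ F1 n ∷ F2 n ∷ F4 n ∷ F5 n ∷ [])
    ispp-necessary = All.++⁺ {xs = K n ∷ K1 n ∷ F1 n ∷ F2 n ∷ []}
      (ispc-necessary {IsppAtMost} bounded (λ {G} → IsppAtMost⇒IspcAtMost {G})) (
      comb-unbounded⇒Any⊑ {IsppAtMost} bounded (inj₁ refl) (F4-realisation n)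
        (λ b → n> (Comb.comb-ispp-lower loHi (inj₁ refl) n 1≤n n refl refl 2≤n b)) ∷
      comb-unbounded⇒Any⊑ {IsppAtMost} bounded (inj₁ refl) (F5-realisation n)
        (λ b → n> (Comb.comb-ispp-lower allThree (inj₁ refl) n 1≤n n refl refl 2≤n b)) ∷ [])

theorem5p2 : (ℋ : List Graph) → All Connected ℋ →
    ((∃ λ c → ∀ (G : Graph) → Connected G → Free ℋ G → IspcAtMost G c)
    ⇔ (∃ λ n → 4 ≤ n × (ℋ ≼ (K n ∷ K1 n ∷ F1 n ∷ F2 n ∷ []))))
    ×
    ((∃ λ c → ∀ (G : Graph) → Connected G → Free ℋ G → IsppAtMost G c)
    ⇔ (∃ λ n → 4 ≤ n × (ℋ ≼ (K n ∷ K1 n ∷ F1 n ∷ F2 n ∷ F4 n ∷ F5 n ∷ []))))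
theorem5p2 ℋ connected =
  mk⇔ (λ (c , bounded) → large c , m≤m+n 4 _ , ispc-necessary ℋ connected c (large c) (2≤large c) (large> c) (size≤large c)
         {IspcAtMost} bounded (λ b → b))
      (λ { (n , 4≤n , k ∷ k1 ∷ f1 ∷ f2 ∷ []) → path-bound (ramsey-number n n) n , λ G conn free →
         BoundedCovers.ispc-bounded G conn (fromℕ< (proj₁ conn)) {n} (≤-trans (s≤s z≤n) 4≤n)
           (forbidden-by {F = K n} {G} k free) (forbidden-by {F = K1 n} {G} k1 free)
           (forbidden-by {F = F1 n} {G} f1 free) (forbidden-by {F = F2 n} {G} f2 free) }) ,
  mk⇔ (λ (c , bounded) → large c , m≤m+n 4 _ , ispp-necessary ℋ connected c (large c) (2≤large c) (large> c) (size≤large c)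
         bounded)
      (λ { (n , 4≤n , k ∷ k1 ∷ f1 ∷ f2 ∷ f4 ∷ f5 ∷ []) → path-bound (ramsey-number n n) n , λ G conn free →
         BoundedCovers.ispp-bounded G conn (fromℕ< (proj₁ conn)) {n} (≤-trans (s≤s z≤n) 4≤n)
           (forbidden-by {F = K n} {G} k free) (forbidden-by {F = K1 n} {G} k1 free)
           (forbidden-by {F = F1 n} {G} f1 free) (forbidden-by {F = F2 n} {G} f2 free)
           (forbidden-by {F = F4 n} {G} f4 free) (forbidden-by {F = F5 n} {G} f5 free) })
  where
  open Necessity
  -- The 4 is demanded by the statement and also makes the value exceed `c * 2`, the number of tips
  -- of c paths; the sum dominates the order of each member of the family.
  large : ℕ → ℕ
  large c = 4 + (c * 2 + sum (map size ℋ))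
  2≤large : ∀ c → 2 ≤ large c
  2≤large c = m≤m+n 2 _
  large> : ∀ c → ¬ large c ≤ c * 2
  large> c = <⇒≱ (≤-trans (s≤s (m≤m+n (c * 2) _)) (m≤n+m _ 3))
  size≤large : ∀ c {H} → H ∈ ℋ → size H ≤ large c
  size≤large c H∈ = ≤-trans (∈⇒≤sum size H∈) (≤-trans (m≤n+m _ (c * 2)) (m≤n+m _ 4))
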